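{- Let $X\subset\mathbb{R}^n$ be a non-empty convex set, $\mathcal{A}\subset\mathbb{R}^n$ a non-empty finite set, and let $\lambda\in\Lambda_X(\mathcal{A},\beta)$ for some $\beta\in\mathcal{A}$. Then $\operatorname{relint}\operatorname{conv}(\operatorname{supp}\lambda)\cap\lambda^+=\emptyset$. Moreover, if $\beta\in\operatorname{conv}(\lambda^+)$, then $\mathcal{A}\lambda=\mathbf{0}$.
   Context: $\mathbb{R}^{\mathcal{A}}$ is the set of real vectors indexed by $\mathcal{A}$. For $\beta\in\mathcal{A}$, $N_\beta=\{\nu\in\mathbb{R}^{\mathcal{A}} : \nu_\alpha\ge 0 \text{ for all }\alpha\in\mathcal{A}\setminus\{\beta\},\ \sum_{\alpha\in\mathcal{A}}\nu_\alpha=0\}$. For $\nu\in\mathbb{R}^{\mathcal{A}}$ write $\mathcal{A}\nu=\sum_{\alpha\in\mathcal{A}}\alpha\,\nu_\alpha\in\mathbb{R}^n$. $\sigma_X(y)=\sup\{y^Tx : x\in X\}$ is the support function. A non-zero vector $\nu^*\in N_\beta$ is an $X$-circuit (sublinear circuit of $\mathcal{A}$ with respect to $X$) if (i) $\sigma_X(-\mathcal{A}\nu^*)<\infty$, and (ii) whenever the map $\nu\mapsto\sigma_X(-\mathcal{A}\nu)$ is linear on a two-dimensional convex cone contained in $N_\beta$ (i.e. is finite there and coincides there with a linear function), $\nu^*$ is not in the relative interior of that cone. An $X$-circuit $\lambda\in N_\beta$ is normalized if $\lambda_\beta=-1$; $\Lambda_X(\mathcal{A},\beta)$ denotes the set of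 normalized $X$-circuits of $\mathcal{A}$ with negative entry at $\beta$. $\operatorname{supp}\lambda=\{\alpha\in\mathcal{A}:\lambda_\alpha\neq0\}$ and $\lambda^+=\{\alpha\in\mathcal{A}:\lambda_\alpha>0\}$. $\operatorname{conv}$ denotes convex hull and $\operatorname{relint}$ relative interior. -}

module Defs where

open import Algebra.Bundles using (CommutativeRing)
open import Algebra.Module.Bundles.Raw using (RawLeftModule)
import Algebra.Module.Construct.TensorUnit as TensorUnit
open import Algebra.Module.Morphism.Structures using (module LeftModuleMorphisms)
import Algebra.Properties.Semiring.Sum as Sum
open import Data.Fin.Base using (Fin)
open import Data.Nat.Base using (ℕ)
open import Data.Product.Base using (∃-syntax; _×_)
open import Data.Vec.Functional using (Vector)
import Data.Vec.Functional.Relation.Binary.Equality.Setoid as Pointwise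
open import Level using (0ℓ; suc)
open import Relation.Binary.Core using (Rel)
open import Relation.Binary.Definitions using (_Respects_)
open import Relation.Binary.PropositionalEquality.Core using (_≢_)
open import Relation.Binary.Structures using (IsDecTotalOrder)
import Relation.Binary.Construct.NonStrictToStrict as ToStrict
open import Relation.Nullary.Negation.Core using (¬_)
open import Relation.Unary using (Pred; _∈_; _∉_; _⊆_; Satisfiable)

IsLUB : {A : Set} → Rel A 0ℓ → Pred A 0ℓ → A → Set
IsLUB _≤_ S s = (∀ {r} → r ∈ S → r ≤ s)
              × (∀ {b} → (∀ {r} → r ∈ S → r ≤ b) → s ≤ b)

-- The library has no real numbers, so ℝ enters axiomatically as a
-- Dedekind-complete ordered field; classically this determines ℝ up to unique
-- isomorphism.  The order is total and decidable, as for the classical reals: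
-- under excluded middle, Dedekind cuts are a model.

record RealField : Set (suc 0ℓ) where
  infix 4 _≤_
  field
    commutativeRing : CommutativeRing 0ℓ 0ℓ
  open CommutativeRing commutativeRing public
  field
    _≤_             : Rel Carrier 0ℓ
    isDecTotalOrder : IsDecTotalOrder _≈_ _≤_
    0≉1             : ¬ 0# ≈ 1#
    inverse         : ∀ {x} → ¬ x ≈ 0# → ∃[ y ] x * y ≈ 1#
    +-monoˡ-≤       : ∀ {x y} z → x ≤ y → x + z ≤ y + z
    *-nonNeg        : ∀ {x y} → 0# ≤ x → 0# ≤ y → 0# ≤ x * y
    complete        : (S : Pred Carrier 0ℓ) → Satisfiable S →
                      (∃[ b ] (∀ {r} → r ∈ S → r ≤ b)) → ∃[ s ] IsLUB _≤_ S s

  open ToStrict _≈_ _≤_ public using (_<_)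

module Geometry (R : RealField) where
  open RealField R
  open Sum semiring using (sum)
  open Pointwise setoid public using (_≋_)

  ℝ : Set
  ℝ = Carrier

  ℝ^ : ℕ → Set
  ℝ^ n = Vector ℝ n

  infixl 6 _+ᵥ_ _-ᵥ_
  infixl 7 _·ᵥ_
  infix  8 -ᵥ_

  0ᵥ : ∀ {n} → ℝ^ n
  0ᵥ k = 0#

  _+ᵥ_ : ∀ {n} → ℝ^ n → ℝ^ n → ℝ^ n
  (x +ᵥ y) k = x k + y k

  -ᵥ_ : ∀ {n} → ℝ^ n → ℝ^ n
  (-ᵥ x) k = - x k

  _-ᵥ_ : ∀ {n} → ℝ^ n → ℝ^ n → ℝ^ n
  x -ᵥ y = x +ᵥ (-ᵥ y)

  _·ᵥ_ : ∀ {n} → ℝ → ℝ^ n → ℝ^ n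
  (t ·ᵥ x) k = t * x k

  ⟨_,_⟩ : ∀ {n} → ℝ^ n → ℝ^ n → ℝ
  ⟨ x , y ⟩ = sum λ k → x k * y k

  combination : ∀ {m n} → (Fin m → ℝ^ n) → ℝ^ m → ℝ^ n
  combination p c k = sum λ i → p i k * c i

  vectorSpace : ℕ → RawLeftModule ℝ 0ℓ 0ℓ
  vectorSpace n = record
    { Carrierᴹ = ℝ^ n
    ; _≈ᴹ_     = _≋_
    ; _+ᴹ_     = _+ᵥ_
    ; _*ₗ_     = _·ᵥ_
    ; 0ᴹ       = 0ᵥ
    ; -ᴹ_      = -ᵥ_
    }

  IsLinear : ∀ {n} → (ℝ^ n → ℝ) → Set
  IsLinear {n} = IsLeftModuleHomomorphism
    where open LeftModuleMorphisms (vectorSpace n) (TensorUnit.rawLeftModule {R = rawRing})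

  conv : ∀ {n} → Pred (ℝ^ n) 0ℓ → Pred (ℝ^ n) 0ℓ
  conv S x = ∃[ k ] ∃[ p ] ∃[ θ ]
    (∀ (i : Fin k) → p i ∈ S) × (∀ i → 0# ≤ θ i) × sum θ ≈ 1# × x ≋ combination p θ

  aff : ∀ {n} → Pred (ℝ^ n) 0ℓ → Pred (ℝ^ n) 0ℓ
  aff S x = ∃[ k ] ∃[ p ] ∃[ θ ]
    (∀ (i : Fin k) → p i ∈ S) × sum θ ≈ 1# × x ≋ combination p θ

  -- Euclidean balls, with the norm squared to avoid square roots.
  relint : ∀ {n} → Pred (ℝ^ n) 0ℓ → Pred (ℝ^ n) 0ℓ
  relint S x = x ∈ S × ∃[ ε ] 0# < ε ×
    (∀ y → y ∈ aff S → ⟨ y -ᵥ x , y -ᵥ x ⟩ < ε * ε → y ∈ S)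

  IsConvex : ∀ {n} → Pred (ℝ^ n) 0ℓ → Set
  IsConvex S = ∀ {x y t} → x ∈ S → y ∈ S → 0# ≤ t → t ≤ 1# →
               ((1# - t) ·ᵥ x +ᵥ t ·ᵥ y) ∈ S

  IsCone : ∀ {n} → Pred (ℝ^ n) 0ℓ → Set
  IsCone K = ∀ {x t} → x ∈ K → 0# ≤ t → t ·ᵥ x ∈ K

  LinearlyIndependent : ∀ {d n} → (Fin d → ℝ^ n) → Set
  LinearlyIndependent b = ∀ c → combination b c ≋ 0ᵥ → c ≋ 0ᵥ

  -- The dimension of a cone is that of its linear span, and a spanning set
  -- contains a basis of its span.
  HasDimension : ∀ {n} → Pred (ℝ^ n) 0ℓ → ℕ → Set
  HasDimension K d = ∃[ b ] (∀ (i : Fin d) → b i ∈ K) × LinearlyIndependent b ×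
    (∀ {x} → x ∈ K → ∃[ c ] x ≋ combination b c)

  -- σ_X(y) = s for a real number s.
  Support : ∀ {n} → Pred (ℝ^ n) 0ℓ → ℝ^ n → ℝ → Set
  Support X y = IsLUB _≤_ λ r → ∃[ x ] x ∈ X × r ≈ ⟨ y , x ⟩

  -- For non-empty X the value σ_X(y) is never -∞, so σ_X(y) < ∞ says that the
  -- supremum is a real number.
  FiniteSupport : ∀ {n} → Pred (ℝ^ n) 0ℓ → ℝ^ n → Set
  FiniteSupport X y = ∃[ s ] Support X y s

  -- The finite set 𝒜 ⊂ ℝⁿ is given by an enumeration (injective in the theorem),
  -- so that ℝ^𝒜 becomes ℝ^ m and β an index.
  module _ {m n : ℕ} (𝒜 : Fin m → ℝ^ n) where

    N : Fin m → Pred (ℝ^ m) 0ℓ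
    N β ν = (∀ i → i ≢ β → 0# ≤ ν i) × sum ν ≈ 0#

    module _ (X : Pred (ℝ^ n) 0ℓ) where

      SupportLinearOn : Pred (ℝ^ m) 0ℓ → Set
      SupportLinearOn K = ∃[ f ] IsLinear f ×
        (∀ {ν} → ν ∈ K → Support X (-ᵥ combination 𝒜 ν) (f ν))

      -- Subsets are predicates compatible with the equality of vectors.
      record IsCircuit (β : Fin m) (ν* : ℝ^ m) : Set (suc 0ℓ) where
        field
          ν*∈N        : ν* ∈ N β
          nonZero     : ¬ ν* ≋ 0ᵥ
          finite      : FiniteSupport X (-ᵥ combination 𝒜 ν*)
          irreducible : (K : Pred (ℝ^ m) 0ℓ) → K Respects _≋_ →
                        IsConvex K → IsCone K → HasDimension K 2 → K ⊆ N β →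
                        SupportLinearOn K → ν* ∉ relint K

      Λ : Fin m → Pred (ℝ^ m) (suc 0ℓ)
      Λ β ν = IsCircuit β ν × ν β ≈ - 1#

    supp : ℝ^ m → Pred (ℝ^ n) 0ℓ
    supp ν α = ∃[ i ] ¬ ν i ≈ 0# × α ≋ 𝒜 i

    _⁺ : ℝ^ m → Pred (ℝ^ n) 0ℓ
    (ν ⁺) α = ∃[ i ] 0# < ν i × α ≋ 𝒜 i

{-# OPTIONS --safe #-}
module Submission where

-- Key fact: if κ is supported on supp ν, sums to 0 and satisfies 𝒜 κ = 0, then
-- κ is a multiple of ν.  Otherwise σ_X(- 𝒜 ·) is linear on the two-dimensional
-- cone spanned by ν ± δ μ, where μ = κ + κ_β ν, because 𝒜 maps this cone to
-- non-negative multiples of 𝒜 ν; for small δ > 0 the cone lies in N_β, and ν is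
-- in its relative interior.
-- If 𝒜 β is a convex combination θ of ν⁺, take κ = e_β - θ: then κ_β ≠ 0, so
-- 𝒜 κ = 0 gives 𝒜 ν = 0.  If 𝒜 j with ν_j > 0 is in the relative interior of
-- conv (supp ν), then (1 + δ) 𝒜 j - δ 𝒜 β is a convex combination θ of supp ν.
-- Now κ = θ + δ e_β - (1 + δ) e_j is a negative multiple of ν, which forces
-- ν = e_j - e_β and 𝒜 j = 𝒜 β.

open import Defs
open import Algebra.Bundles using (CommutativeRing)
import Algebra.Properties.AbelianGroup
import Algebra.Properties.Ring
import Algebra.Properties.Semiring.Mult.TCOptimised
import Algebra.Properties.Semiring.Sum as Sum
import Algebra.Solver.Ring
open import Algebra.Solver.Ring.AlmostCommutativeRing
  using (fromCommutativeRing; _-Raw-AlmostCommutative⟶_)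
open import Data.Fin.Base using (Fin; zero; suc)
import Data.Fin.Properties as Fin
open import Data.Integer.Base as ℤ using (ℤ; +_; -[1+_]; _⊖_)
import Data.Integer.Properties as ℤ
open import Data.Maybe.Base using (map)
open import Data.Nat.Base as ℕ using (ℕ; zero; suc)
open import Data.Product.Base using (_×_; _,_; proj₁; proj₂; ∃-syntax)
open import Data.Sum.Base using (inj₁; inj₂)
open import Function.Base using (_∘_)
open import Function.Definitions using (Injective)
open import Level using (0ℓ)
open import Relation.Binary.Consequences using (dec⇒weaklyDec)
open import Relation.Binary.Definitions using (_Respects_)
open import Relation.Binary.PropositionalEquality.Core as ≡ using (_≡_; _≢_)
import Relation.Binary.Reasoning.Setoid
open import Relation.Binary.Structures using (IsDecTotalOrder)
open import Relation.Nullary.Decidable.Core using (yes; no)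
open import Relation.Nullary.Negation.Core using (¬_; contradiction)
open import Relation.Unary using (Pred; _∈_; _∩_; Empty; Satisfiable)

-- Unlike Algebra.Solver.Ring.Simple, integer coefficients let the solver
-- cancel x against - x in an abstract ring.

module IntegerCoefficients {c ℓ} (R : CommutativeRing c ℓ) where
  open CommutativeRing R
  open Algebra.Properties.Ring ring
  open Algebra.Properties.AbelianGroup +-abelianGroup using (⁻¹-involutive; ⁻¹-∙-comm; ε⁻¹≈ε)
  open Algebra.Properties.Semiring.Mult.TCOptimised semiring
    using (×-homo-+; 1+×; ×1-homo-*) renaming (_×_ to infixl 8 _·_)
  open Relation.Binary.Reasoning.Setoid setoid

  -- Since `1 · 1#` reduces to `1#`, the solver constants `con (+ 0)` and `con (+ 1)` denote `0#`
  -- and `1#` definitionally, so solved equations fit the goals by `refl`.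
  fromℤ : ℤ → Carrier
  fromℤ (+ n)    = n · 1#
  fromℤ -[1+ n ] = - (suc n · 1#)

  private
    cong-fromℤ : ∀ {i j} → i ≡.≡ j → fromℤ i ≈ fromℤ j
    cong-fromℤ ≡.refl = refl

  fromℤ-neg : ∀ i → fromℤ (ℤ.- i) ≈ - fromℤ i
  fromℤ-neg (+ zero)  = sym ε⁻¹≈ε
  fromℤ-neg (+ suc n) = refl
  fromℤ-neg -[1+ n ]  = sym (⁻¹-involutive _)

  fromℤ-⊖ : ∀ m n → fromℤ (m ⊖ n) ≈ m · 1# - n · 1#
  fromℤ-⊖ m zero = begin
    m · 1#          ≈⟨ +-identityʳ _ ⟨
    m · 1# + 0#     ≈⟨ +-congˡ ε⁻¹≈ε ⟨
    m · 1# - 0#     ∎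
  fromℤ-⊖ zero    (suc n) = sym (+-identityˡ _)
  fromℤ-⊖ (suc m) (suc n) = begin
    fromℤ (suc m ⊖ suc n)                    ≈⟨ cong-fromℤ (ℤ.[1+m]⊖[1+n]≡m⊖n m n) ⟩
    fromℤ (m ⊖ n)                            ≈⟨ fromℤ-⊖ m n ⟩
    -- Inserts `1# - 1#`, whose two halves turn the multiples into those of `suc m` and `suc n`.
    m · 1# - n · 1#                          ≈⟨ +-congʳ (+-identityˡ _) ⟨
    (0# + m · 1#) - n · 1#                   ≈⟨ +-congʳ (+-congʳ (-‿inverseʳ 1#)) ⟨
    ((1# - 1#) + m · 1#) - n · 1#            ≈⟨ +-congʳ (+-assoc _ _ _) ⟩
    (1# + (- 1# + m · 1#)) - n · 1#          ≈⟨ +-congʳ (+-congˡ (+-comm _ _)) ⟩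
    (1# + (m · 1# - 1#)) - n · 1#            ≈⟨ +-congʳ (+-assoc _ _ _) ⟨
    ((1# + m · 1#) - 1#) - n · 1#            ≈⟨ +-assoc _ _ _ ⟩
    (1# + m · 1#) + (- 1# - n · 1#)          ≈⟨ +-congˡ (⁻¹-∙-comm _ _) ⟩
    (1# + m · 1#) - (1# + n · 1#)            ≈⟨ +-cong (1+× m 1#) (-‿cong (1+× n 1#)) ⟨
    suc m · 1# - suc n · 1#                  ∎

  fromℤ-+ : ∀ i j → fromℤ (i ℤ.+ j) ≈ fromℤ i + fromℤ j
  fromℤ-+ (+ m)    (+ n)    = ×-homo-+ 1# m n
  fromℤ-+ (+ m)    -[1+ n ] = fromℤ-⊖ m (suc n)
  fromℤ-+ -[1+ m ] (+ n)    = trans (fromℤ-⊖ n (suc m)) (+-comm _ _)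
  fromℤ-+ -[1+ m ] -[1+ n ] = begin
    - (suc (suc (m ℕ.+ n)) · 1#)      ≈⟨ -‿cong (1+× (suc (m ℕ.+ n)) 1#) ⟩
    - (1# + (suc m ℕ.+ n) · 1#)       ≈⟨ -‿cong (+-congˡ (×-homo-+ 1# (suc m) n)) ⟩
    - (1# + (suc m · 1# + n · 1#))    ≈⟨ -‿cong (+-assoc _ _ _) ⟨
    - ((1# + suc m · 1#) + n · 1#)    ≈⟨ -‿cong (+-congʳ (+-comm _ _)) ⟩
    - ((suc m · 1# + 1#) + n · 1#)    ≈⟨ -‿cong (+-assoc _ _ _) ⟩
    - (suc m · 1# + (1# + n · 1#))    ≈⟨ -‿cong (+-congˡ (1+× n 1#)) ⟨
    - (suc m · 1# + suc n · 1#)       ≈⟨ ⁻¹-∙-comm _ _ ⟨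
    - (suc m · 1#) - suc n · 1#       ∎

  fromℤ-*-nonNeg : ∀ m j → fromℤ (+ m ℤ.* j) ≈ m · 1# * fromℤ j
  fromℤ-*-nonNeg m (+ n) = begin
    fromℤ (+ m ℤ.* + n)               ≈⟨ cong-fromℤ (ℤ.pos-* m n) ⟨
    (m ℕ.* n) · 1#                    ≈⟨ ×1-homo-* m n ⟩
    (m · 1#) * (n · 1#)               ∎
  fromℤ-*-nonNeg m -[1+ n ] = begin
    fromℤ (+ m ℤ.* -[1+ n ])          ≈⟨ cong-fromℤ (ℤ.neg-distribʳ-* (+ m) (+ suc n)) ⟨
    fromℤ (ℤ.- (+ m ℤ.* + suc n))     ≈⟨ fromℤ-neg (+ m ℤ.* + suc n) ⟩
    - fromℤ (+ m ℤ.* + suc n)         ≈⟨ -‿cong (fromℤ-*-nonNeg m (+ suc n)) ⟩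
    - (m · 1# * suc n · 1#)           ≈⟨ -‿distribʳ-* _ _ ⟩
    m · 1# * - (suc n · 1#)           ∎

  fromℤ-* : ∀ i j → fromℤ (i ℤ.* j) ≈ fromℤ i * fromℤ j
  fromℤ-* (+ m)    j = fromℤ-*-nonNeg m j
  fromℤ-* -[1+ m ] j = begin
    fromℤ (-[1+ m ] ℤ.* j)            ≈⟨ cong-fromℤ (ℤ.neg-distribˡ-* (+ suc m) j) ⟨
    fromℤ (ℤ.- (+ suc m ℤ.* j))       ≈⟨ fromℤ-neg (+ suc m ℤ.* j) ⟩
    - fromℤ (+ suc m ℤ.* j)           ≈⟨ -‿cong (fromℤ-*-nonNeg (suc m) j) ⟩
    - (suc m · 1# * fromℤ j)          ≈⟨ -‿distribˡ-* _ _ ⟩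
    - (suc m · 1#) * fromℤ j          ∎

  morphism : ℤ.+-*-rawRing -Raw-AlmostCommutative⟶ fromCommutativeRing R
  morphism = record
    { ⟦_⟧    = fromℤ
    ; +-homo = fromℤ-+
    ; *-homo = fromℤ-*
    ; -‿homo = fromℤ-neg
    ; 0-homo = refl
    ; 1-homo = refl
    }

  open Algebra.Solver.Ring ℤ.+-*-rawRing (fromCommutativeRing R) morphism
    (λ i j → map cong-fromℤ (dec⇒weaklyDec ℤ._≟_ i j)) public
    using (solve; con; _:+_; _:*_; _:-_; :-_; _:=_)

module CircuitTheory (R : RealField) where
  open RealField R hiding (zero)
  open Geometry R
  open IntegerCoefficients commutativeRing
  open Sum semiring
    using (sum; sum-cong-≋; sum-replicate-zero; ∑-distrib-+; ∑-comm; *-distribˡ-sum; *-distribʳ-sum)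
  open Relation.Binary.Reasoning.Setoid setoid
  open IsDecTotalOrder isDecTotalOrder using (_≟_)
    renaming (refl to ≤-refl; trans to ≤-trans; antisym to ≤-antisym; total to ≤-total;
              ≤-respʳ-≈ to ≤-respʳ; ≤-respˡ-≈ to ≤-respˡ)

  -- Ordered-field arithmetic

  ≤⇒0≤- : ∀ {x y} → x ≤ y → 0# ≤ y - x
  ≤⇒0≤- {x} x≤y = ≤-respˡ (-‿inverseʳ x) (+-monoˡ-≤ (- x) x≤y)

  0≤-⇒≤ : ∀ {x y} → 0# ≤ y - x → x ≤ y
  0≤-⇒≤ {x} {y} 0≤y-x = ≤-respˡ (+-identityˡ x)
    (≤-respʳ (solve 2 (λ x y → y :- x :+ x := y) refl x y) (+-monoˡ-≤ x 0≤y-x))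

  ≤0⇒0≤- : ∀ {x} → x ≤ 0# → 0# ≤ - x
  ≤0⇒0≤- x≤0 = ≤-respʳ (+-identityˡ _) (≤⇒0≤- x≤0)

  +-nonNeg : ∀ {x y} → 0# ≤ x → 0# ≤ y → 0# ≤ x + y
  +-nonNeg {x} {y} 0≤x 0≤y = ≤-trans (≤-respʳ (sym (+-identityˡ y)) 0≤y) (+-monoˡ-≤ y 0≤x)

  *-monoˡ-≤ : ∀ {x y z} → 0# ≤ z → x ≤ y → z * x ≤ z * y
  *-monoˡ-≤ {x} {y} {z} 0≤z x≤y = 0≤-⇒≤ (≤-respʳ
    (solve 3 (λ x y z → z :* (y :- x) := z :* y :- z :* x) refl x y z)
    (*-nonNeg 0≤z (≤⇒0≤- x≤y)))

  square-nonNeg : ∀ x → 0# ≤ x * x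
  square-nonNeg x with ≤-total 0# x
  ... | inj₁ 0≤x = *-nonNeg 0≤x 0≤x
  ... | inj₂ x≤0 = ≤-respʳ (solve 1 (λ x → :- x :* :- x := x :* x) refl x)
    (*-nonNeg (≤0⇒0≤- x≤0) (≤0⇒0≤- x≤0))

  square-mono-≤ : ∀ {x y} → 0# ≤ x → x ≤ y → x * x ≤ y * y
  square-mono-≤ {x} {y} 0≤x x≤y = ≤-trans (*-monoˡ-≤ 0≤x x≤y)
    (≤-respˡ (*-comm y x) (*-monoˡ-≤ (≤-trans 0≤x x≤y) x≤y))

  0≤1 : 0# ≤ 1#
  0≤1 = ≤-respʳ (*-identityˡ 1#) (square-nonNeg 1#)

  0<1 : 0# < 1#
  0<1 = 0≤1 , 0≉1

  <⇒≉0 : ∀ {x} → 0# < x → ¬ x ≈ 0#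
  <⇒≉0 (_ , 0≉x) x≈0 = 0≉x (sym x≈0)

  <-respʳ : ∀ {x y} → x ≈ y → 0# < x → 0# < y
  <-respʳ x≈y (0≤x , 0≉x) = ≤-respʳ x≈y 0≤x , λ 0≈y → 0≉x (trans 0≈y (sym x≈y))

  ¬0<-1 : ¬ 0# < - 1#
  ¬0<-1 (0≤-1 , _) = 0≉1 (≤-antisym 0≤1 (0≤-⇒≤ (≤-respʳ (sym (+-identityˡ _)) 0≤-1)))

  +-pos : ∀ {x y} → 0# < x → 0# ≤ y → 0# < x + y
  +-pos {x} {y} (0≤x , 0≉x) 0≤y = +-nonNeg 0≤x 0≤y , λ 0≈x+y →
    0≉x (≤-antisym 0≤x (0≤-⇒≤ (≤-respʳ (begin
      y               ≈⟨ solve 2 (λ x y → y := (x :+ y) :- x) refl x y ⟩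
      (x + y) - x     ≈⟨ +-congʳ 0≈x+y ⟨
      0# - x          ∎) 0≤y)))

  0<-⇒< : ∀ {x y} → 0# < y - x → x < y
  0<-⇒< {x} {y} (0≤y-x , 0≉y-x) = 0≤-⇒≤ 0≤y-x , λ x≈y →
    0≉y-x (sym (trans (+-congˡ (-‿cong x≈y)) (-‿inverseʳ y)))


  0<2 : 0# < 1# + 1#
  0<2 = +-pos 0<1 0≤1

  *-pos : ∀ {x y} → 0# < x → 0# < y → 0# < x * y
  *-pos {x} {y} 0<x@(0≤x , _) (0≤y , 0≉y) = *-nonNeg 0≤x 0≤y , λ 0≈xy →
    let x⁻¹ , xx⁻¹≈1 = inverse (<⇒≉0 0<x) in 0≉y (begin
      0#               ≈⟨ zeroʳ x⁻¹ ⟨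
      x⁻¹ * 0#         ≈⟨ *-congˡ 0≈xy ⟩
      x⁻¹ * (x * y)    ≈⟨ solve 3 (λ x y z → z :* (x :* y) := (x :* z) :* y) refl x y x⁻¹ ⟩
      (x * x⁻¹) * y    ≈⟨ *-congʳ xx⁻¹≈1 ⟩
      1# * y           ≈⟨ *-identityˡ y ⟩
      y                ∎)

  -- An inverse `y ≤ 0#` would make `- 1#`, which equals `x * - y`, positive.
  inverse-pos : ∀ {x} → 0# < x → ∃[ y ] 0# < y × x * y ≈ 1#
  inverse-pos {x} 0<x@(0≤x , _) with inverse (<⇒≉0 0<x)
  ... | y , xy≈1 with ≤-total 0# y
  ...   | inj₁ 0≤y = y , (0≤y , λ 0≈y →
            0≉1 (trans (sym (zeroʳ x)) (trans (*-congˡ 0≈y) xy≈1))) , xy≈1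
  ...   | inj₂ y≤0 = contradiction
            (≤-respʳ (trans (solve 2 (λ x y → x :* :- y := :- (x :* y)) refl x y) (-‿cong xy≈1))
              (*-nonNeg 0≤x (≤0⇒0≤- y≤0)) ,
             λ 0≈-1 → 0≉1 (begin
               0#          ≈⟨ solve 0 (con (+ 0) := :- con (+ 0)) refl ⟩
               - 0#        ≈⟨ -‿cong 0≈-1 ⟩
               - - 1#      ≈⟨ solve 0 (:- :- con (+ 1) := con (+ 1)) refl ⟩
               1#          ∎)) ¬0<-1

  *-cancel-nonNeg : ∀ {x y} → 0# < x → 0# ≤ x * y → 0# ≤ y
  *-cancel-nonNeg {x} {y} 0<x 0≤xy with inverse-pos 0<x
  ... | x⁻¹ , (0≤x⁻¹ , _) , xx⁻¹≈1 = ≤-respʳ (begin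
      x⁻¹ * (x * y)    ≈⟨ solve 3 (λ x y z → z :* (x :* y) := (x :* z) :* y) refl x y x⁻¹ ⟩
      (x * x⁻¹) * y    ≈⟨ *-congʳ xx⁻¹≈1 ⟩
      1# * y           ≈⟨ *-identityˡ y ⟩
      y                ∎) (*-nonNeg 0≤x⁻¹ 0≤xy)

  -- Properties of all small non-negative scalars

  -- Closure under finite conjunction yields one `δ` for finitely many inequalities without
  -- computing a minimum. The interval is closed at `δ`, so `δ` itself can serve as the scalar.
  Eventually : Pred Carrier 0ℓ → Set
  Eventually P = ∃[ δ ] 0# < δ × (∀ {t} → 0# ≤ t → t ≤ δ → P t)

  private
    variable
      d m n : ℕ
      P Q   : Pred Carrier 0ℓ

  eventually-× : Eventually P → Eventually Q → Eventually (λ t → P t × Q t)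
  eventually-× (δ , 0<δ , p) (δ′ , 0<δ′ , q) with ≤-total δ δ′
  ... | inj₁ δ≤δ′ = δ  , 0<δ  , λ 0≤t t≤δ  → p 0≤t t≤δ , q 0≤t (≤-trans t≤δ δ≤δ′)
  ... | inj₂ δ′≤δ = δ′ , 0<δ′ , λ 0≤t t≤δ′ → p 0≤t (≤-trans t≤δ′ δ′≤δ) , q 0≤t t≤δ′

  eventually-∀ : ∀ {n} {P : Fin n → Pred Carrier 0ℓ} →
                 (∀ i → Eventually (P i)) → Eventually (λ t → ∀ i → P i t)
  eventually-∀ {zero}  _ = 1# , 0<1 , λ _ _ ()
  eventually-∀ {suc n} h with eventually-× (h zero) (eventually-∀ (λ i → h (suc i)))
  ... | δ , 0<δ , p = δ , 0<δ , λ 0≤t t≤δ → λ where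
    zero    → proj₁ (p 0≤t t≤δ)
    (suc i) → proj₂ (p 0≤t t≤δ) i

  eventually-affine-nonNeg : ∀ {x} y → 0# < x → Eventually (λ t → 0# ≤ x + t * y)
  eventually-affine-nonNeg {x} y 0<x@(0≤x , _) with ≤-total 0# y
  ... | inj₁ 0≤y = 1# , 0<1 , λ 0≤t _ → +-nonNeg 0≤x (*-nonNeg 0≤t 0≤y)
  ... | inj₂ y≤0 with inverse-pos (+-pos 0<1 (≤0⇒0≤- y≤0))
  -- The bound is x / (1 - y); the denominator 1 - y, unlike - y, is positive also for y = 0. Below
  -- the bound, x + t y = (1 - y) (x z - t) + t is a sum of non-negative terms.
  ...   | z , 0<z , [1-y]z≈1 = x * z , *-pos 0<x 0<z , λ {t} 0≤t t≤xz →
    ≤-respʳ (begin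
      (1# - y) * (x * z - t) + t         ≈⟨ solve 4 (λ x y z t → (con (+ 1) :- y) :* (x :* z :- t) :+ t
                                              := x :* ((con (+ 1) :- y) :* z) :+ t :* y) refl x y z t ⟩
      x * ((1# - y) * z) + t * y         ≈⟨ +-congʳ (*-congˡ [1-y]z≈1) ⟩
      x * 1# + t * y                     ≈⟨ +-congʳ (*-identityʳ x) ⟩
      x + t * y                          ∎)
    (+-nonNeg (*-nonNeg (+-nonNeg 0≤1 (≤0⇒0≤- y≤0)) (≤⇒0≤- t≤xz)) 0≤t)

  -- Covers the coordinates of a perturbed circuit: where the circuit vanishes there is no room to
  -- move, so the direction has to vanish too.
  eventually-affine-nonNeg₀ : ∀ {x y} → 0# ≤ x → (x ≈ 0# → y ≈ 0#) → Eventually (λ t → 0# ≤ x + t * y)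
  eventually-affine-nonNeg₀ {x} {y} 0≤x y≈0 with x ≟ 0#
  ... | no  x≉0 = eventually-affine-nonNeg y (0≤x , λ 0≈x → x≉0 (sym 0≈x))
  ... | yes x≈0 = 1# , 0<1 , λ {t} _ _ → ≤-respʳ (begin
      x              ≈⟨ +-identityʳ x ⟨
      x + 0#         ≈⟨ +-congˡ (trans (*-congˡ (y≈0 x≈0)) (zeroʳ t)) ⟨
      x + t * y      ∎) 0≤x

  -- The inner product

  sum-nonNeg : (x : ℝ^ n) → (∀ i → 0# ≤ x i) → 0# ≤ sum x
  sum-nonNeg {zero}  x 0≤x = ≤-refl
  sum-nonNeg {suc n} x 0≤x = +-nonNeg (0≤x zero) (sum-nonNeg (x ∘ suc) (0≤x ∘ suc))

  ⟨⟩-cong : {x x′ y y′ : ℝ^ n} → x ≋ x′ → y ≋ y′ → ⟨ x , y ⟩ ≈ ⟨ x′ , y′ ⟩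
  ⟨⟩-cong x≋x′ y≋y′ = sum-cong-≋ (λ i → *-cong (x≋x′ i) (y≋y′ i))

  ⟨⟩-congˡ : (x : ℝ^ n) {y y′ : ℝ^ n} → y ≋ y′ → ⟨ x , y ⟩ ≈ ⟨ x , y′ ⟩
  ⟨⟩-congˡ x y≋y′ = sum-cong-≋ (λ i → *-congˡ (y≋y′ i))

  ⟨⟩-congʳ : (y : ℝ^ n) {x x′ : ℝ^ n} → x ≋ x′ → ⟨ x , y ⟩ ≈ ⟨ x′ , y ⟩
  ⟨⟩-congʳ y x≋x′ = sum-cong-≋ (λ i → *-congʳ (x≋x′ i))

  ⟨⟩-comm : (x y : ℝ^ n) → ⟨ x , y ⟩ ≈ ⟨ y , x ⟩
  ⟨⟩-comm x y = sum-cong-≋ (λ i → *-comm (x i) (y i))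

  ⟨⟩-+ : (x y z : ℝ^ n) → ⟨ x , y +ᵥ z ⟩ ≈ ⟨ x , y ⟩ + ⟨ x , z ⟩
  ⟨⟩-+ x y z = trans (sum-cong-≋ (λ i → distribˡ (x i) (y i) (z i)))
    (∑-distrib-+ (λ i → x i * y i) (λ i → x i * z i))

  ⟨⟩-· : (x : ℝ^ n) (t : ℝ) (y : ℝ^ n) → ⟨ x , t ·ᵥ y ⟩ ≈ t * ⟨ x , y ⟩
  ⟨⟩-· x t y = trans
    (sum-cong-≋ (λ i → solve 3 (λ x t y → x :* (t :* y) := t :* (x :* y)) refl (x i) t (y i)))
    (sym (*-distribˡ-sum t (λ i → x i * y i)))

  ⟨⟩-neg : (x y : ℝ^ n) → ⟨ x , -ᵥ y ⟩ ≈ - ⟨ x , y ⟩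
  ⟨⟩-neg x y = begin
    ⟨ x , -ᵥ y ⟩            ≈⟨ ⟨⟩-congˡ x (λ i → solve 1 (λ y → :- y := (:- con (+ 1)) :* y) refl (y i)) ⟩
    ⟨ x , (- 1#) ·ᵥ y ⟩     ≈⟨ ⟨⟩-· x (- 1#) y ⟩
    - 1# * ⟨ x , y ⟩        ≈⟨ solve 1 (λ y → (:- con (+ 1)) :* y := :- y) refl ⟨ x , y ⟩ ⟩
    - ⟨ x , y ⟩             ∎

  ⟨⟩-0 : (x : ℝ^ n) → ⟨ x , 0ᵥ ⟩ ≈ 0#
  ⟨⟩-0 {n} x = trans (sum-cong-≋ (λ i → zeroʳ (x i))) (sum-replicate-zero n)

  -- Interchange of two finite sums. As `combination b c k` unfolds to `⟨ (λ i → b i k) , c ⟩`, this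
  -- also gives associativity of combinations, coordinate by coordinate.
  ⟨⟩-combination : (x : ℝ^ n) (b : Fin d → ℝ^ n) (c : ℝ^ d) →
                   ⟨ x , combination b c ⟩ ≈ ⟨ (λ i → ⟨ x , b i ⟩) , c ⟩
  ⟨⟩-combination x b c = begin
    sum (λ k → x k * sum (λ i → b i k * c i))
      ≈⟨ sum-cong-≋ (λ k → *-distribˡ-sum (x k) (λ i → b i k * c i)) ⟩
    sum (λ k → sum (λ i → x k * (b i k * c i)))
      ≈⟨ ∑-comm (λ k i → x k * (b i k * c i)) ⟩
    sum (λ i → sum (λ k → x k * (b i k * c i)))
      ≈⟨ sum-cong-≋ (λ i → sum-cong-≋ (λ k → *-assoc (x k) (b i k) (c i))) ⟨
    sum (λ i → sum (λ k → x k * b i k * c i))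
      ≈⟨ sum-cong-≋ (λ i → *-distribʳ-sum (c i) (λ k → x k * b i k)) ⟨
    sum (λ i → ⟨ x , b i ⟩ * c i)
      ∎

  ⟨⟩-isLinear : (x : ℝ^ n) → IsLinear ⟨ x ,_⟩
  ⟨⟩-isLinear x = record
    { +ᴹ-isGroupHomomorphism = record
      { isMonoidHomomorphism = record
        { isMagmaHomomorphism = record
          { isRelHomomorphism = record { cong = ⟨⟩-congˡ x }
          ; homo              = ⟨⟩-+ x
          }
        ; ε-homo = ⟨⟩-0 x
        }
      ; ⁻¹-homo = ⟨⟩-neg x
      }
    ; *ₗ-homo = ⟨⟩-· x
    }

  ⟨⟩-nonNeg : {x y : ℝ^ n} → (∀ i → 0# ≤ x i) → (∀ i → 0# ≤ y i) → 0# ≤ ⟨ x , y ⟩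
  ⟨⟩-nonNeg 0≤x 0≤y = sum-nonNeg _ (λ i → *-nonNeg (0≤x i) (0≤y i))

  norm²-nonNeg : (x : ℝ^ n) → 0# ≤ ⟨ x , x ⟩
  norm²-nonNeg x = sum-nonNeg _ (λ i → square-nonNeg (x i))

  -- With the sum written as a pairing, the conditions on `sum` and on each coordinate of
  -- `combination 𝒜` become instances of one evaluation of `⟨ x ,_⟩`.
  sum≈⟨1,⟩ : (x : ℝ^ n) → sum x ≈ ⟨ (λ _ → 1#) , x ⟩
  sum≈⟨1,⟩ x = sum-cong-≋ (λ i → sym (*-identityˡ (x i)))

  -- The standard basis, defined by recursion on both indices so that `⟨⟩-e` follows by induction.
  e : Fin n → ℝ^ n
  e zero    zero    = 1#
  e zero    (suc j) = 0#
  e (suc i) zero    = 0#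
  e (suc i) (suc j) = e i j

  e-diag : (i : Fin n) → e i i ≡ 1#
  e-diag zero    = ≡.refl
  e-diag (suc i) = e-diag i

  e-off : {i j : Fin n} → i ≢ j → e i j ≡ 0#
  e-off {i = zero}  {zero}  i≢j = contradiction ≡.refl i≢j
  e-off {i = zero}  {suc j} i≢j = ≡.refl
  e-off {i = suc i} {zero}  i≢j = ≡.refl
  e-off {i = suc i} {suc j} i≢j = e-off (i≢j ∘ ≡.cong suc)

  e-nonNeg : (i j : Fin n) → 0# ≤ e i j
  e-nonNeg zero    zero    = 0≤1
  e-nonNeg zero    (suc j) = ≤-refl
  e-nonNeg (suc i) zero    = ≤-refl
  e-nonNeg (suc i) (suc j) = e-nonNeg i j

  ⟨⟩-e : (x : ℝ^ n) (i : Fin n) → ⟨ x , e i ⟩ ≈ x i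
  ⟨⟩-e x zero = begin
    x zero * 1# + ⟨ x ∘ suc , 0ᵥ ⟩   ≈⟨ +-cong (*-identityʳ _) (⟨⟩-0 (x ∘ suc)) ⟩
    x zero + 0#                      ≈⟨ +-identityʳ _ ⟩
    x zero                           ∎
  ⟨⟩-e x (suc i) = begin
    x zero * 0# + ⟨ x ∘ suc , e i ⟩  ≈⟨ +-cong (zeroʳ _) (⟨⟩-e (x ∘ suc) i) ⟩
    0# + x (suc i)                   ≈⟨ +-identityˡ _ ⟩
    x (suc i)                        ∎

  combination-assoc : ∀ {l} (b : Fin d → ℝ^ n) (c : Fin l → ℝ^ d) (θ : ℝ^ l) →
    combination b (combination c θ) ≋ combination (λ i → combination b (c i)) θ
  combination-assoc b c θ k = ⟨⟩-combination (λ j → b j k) c θ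

  norm²-expand : (t : ℝ) (x y : ℝ^ n) →
    ⟨ t ·ᵥ x +ᵥ y , t ·ᵥ x +ᵥ y ⟩ ≈ t * (t * ⟨ x , x ⟩ + (⟨ x , y ⟩ + ⟨ x , y ⟩)) + ⟨ y , y ⟩
  norm²-expand t x y = begin
    ⟨ z , z ⟩
      ≈⟨ ⟨⟩-+ z (t ·ᵥ x) y ⟩
    ⟨ z , t ·ᵥ x ⟩ + ⟨ z , y ⟩
      ≈⟨ +-cong (trans (⟨⟩-· z t x) (*-congˡ (inner x))) (inner y) ⟩
    t * (t * ⟨ x , x ⟩ + ⟨ x , y ⟩) + (t * ⟨ y , x ⟩ + ⟨ y , y ⟩)
      ≈⟨ +-congˡ (+-congʳ (*-congˡ (⟨⟩-comm y x))) ⟩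
    t * (t * ⟨ x , x ⟩ + ⟨ x , y ⟩) + (t * ⟨ x , y ⟩ + ⟨ y , y ⟩)
      ≈⟨ solve 4 (λ t a b c → t :* (t :* a :+ b) :+ (t :* b :+ c) := t :* (t :* a :+ (b :+ b)) :+ c)
           refl t ⟨ x , x ⟩ ⟨ x , y ⟩ ⟨ y , y ⟩ ⟩
    t * (t * ⟨ x , x ⟩ + (⟨ x , y ⟩ + ⟨ x , y ⟩)) + ⟨ y , y ⟩
      ∎
    where
    z = t ·ᵥ x +ᵥ y
    inner : ∀ w → ⟨ z , w ⟩ ≈ t * ⟨ w , x ⟩ + ⟨ w , y ⟩
    inner w = begin
      ⟨ z , w ⟩                        ≈⟨ ⟨⟩-comm z w ⟩
      ⟨ w , z ⟩                        ≈⟨ ⟨⟩-+ w (t ·ᵥ x) y ⟩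
      ⟨ w , t ·ᵥ x ⟩ + ⟨ w , y ⟩       ≈⟨ +-congʳ (⟨⟩-· w t x) ⟩
      t * ⟨ w , x ⟩ + ⟨ w , y ⟩        ∎

  -- With r = ⟨g,x⟩ / (1 + |g|²), the inequality 0 ≤ |r g + (z - x)|² replaces
  -- the Cauchy–Schwarz bound on ⟨g, z - x⟩.
  nonNeg-near : (g x : ℝ^ n) → 0# < ⟨ g , x ⟩ →
    Eventually (λ t → ∀ z → ⟨ z -ᵥ x , z -ᵥ x ⟩ < t * t → 0# ≤ ⟨ g , z ⟩)
  nonNeg-near g x 0<G@(0≤G , _) with inverse-pos (+-pos 0<1 (norm²-nonNeg g))
  ... | s , 0<s , [1+g²]s≈1 = r , *-pos 0<G 0<s , λ {t} 0≤t t≤r z (near , _) →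
    let w      = z -ᵥ x
        w²≤r²  = ≤-trans near (square-mono-≤ 0≤t t≤r)
        -- Expanding 0 ≤ |r g + w|² and bounding |w|² by r² gives 0 ≤ r (r (1 + |g|²) + 2⟨g,w⟩) = r
        -- (G + 2⟨g,w⟩), and `r` is positive. Adding `G` once more gives 2⟨g,z⟩, as z = x + w.
        G+2gw  = *-cancel-nonNeg {r} {G + (⟨ g , w ⟩ + ⟨ g , w ⟩)} (*-pos 0<G 0<s) (≤-respʳ (begin
          r * (r * g² + (⟨ g , w ⟩ + ⟨ g , w ⟩)) + ⟨ w , w ⟩ + (r * r - ⟨ w , w ⟩)
            ≈⟨ solve 4 (λ r a b c → r :* (r :* a :+ (b :+ b)) :+ c :+ (r :* r :- c)
                 := r :* (r :* (con (+ 1) :+ a) :+ (b :+ b))) refl r g² ⟨ g , w ⟩ ⟨ w , w ⟩ ⟩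
          r * (r * (1# + g²) + (⟨ g , w ⟩ + ⟨ g , w ⟩))
            ≈⟨ *-congˡ (+-congʳ r[1+g²]≈G) ⟩
          r * (G + (⟨ g , w ⟩ + ⟨ g , w ⟩))
            ∎)
          (+-nonNeg (≤-respʳ (norm²-expand r g w) (norm²-nonNeg (r ·ᵥ g +ᵥ w))) (≤⇒0≤- w²≤r²)))
    in *-cancel-nonNeg {1# + 1#} 0<2 (≤-respʳ (begin
         G + (⟨ g , w ⟩ + ⟨ g , w ⟩) + G
           ≈⟨ solve 2 (λ a b → a :+ (b :+ b) :+ a := (con (+ 1) :+ con (+ 1)) :* (a :+ b)) refl G ⟨ g , w ⟩ ⟩
         (1# + 1#) * (G + ⟨ g , w ⟩)
           ≈⟨ *-congˡ (⟨⟩-+ g x w) ⟨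
         (1# + 1#) * ⟨ g , x +ᵥ w ⟩
           ≈⟨ *-congˡ (⟨⟩-congˡ g (λ k → solve 2 (λ x z → x :+ (z :- x) := z) refl (x k) (z k))) ⟩
         (1# + 1#) * ⟨ g , z ⟩
           ∎)
         (+-nonNeg G+2gw 0≤G))
    where
    G  = ⟨ g , x ⟩
    g² = ⟨ g , g ⟩
    r  = G * s
    r[1+g²]≈G : r * (1# + g²) ≈ G
    r[1+g²]≈G = begin
      G * s * (1# + g²)       ≈⟨ solve 3 (λ a b c → a :* b :* c := a :* (c :* b)) refl G s (1# + g²) ⟩
      G * ((1# + g²) * s)     ≈⟨ *-congˡ [1+g²]s≈1 ⟩
      G * 1#                  ≈⟨ *-identityʳ G ⟩
      G                       ∎

  -- Finitely generated cones and support functions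

  cone : (Fin d → ℝ^ n) → Pred (ℝ^ n) 0ℓ
  cone b x = ∃[ c ] (∀ i → 0# ≤ c i) × x ≋ combination b c

  cone-respects : (b : Fin d → ℝ^ n) → cone b Respects _≋_
  cone-respects b x≋y (c , 0≤c , x≋bc) = c , 0≤c , λ k → trans (sym (x≋y k)) (x≋bc k)

  cone-isCone : (b : Fin d → ℝ^ n) → IsCone (cone b)
  cone-isCone b {t = t} (c , 0≤c , x≋bc) 0≤t =
    t ·ᵥ c , (λ i → *-nonNeg 0≤t (0≤c i)) ,
    λ k → trans (*-congˡ (x≋bc k)) (sym (⟨⟩-· (λ i → b i k) t c))

  cone-isConvex : (b : Fin d → ℝ^ n) → IsConvex (cone b)
  cone-isConvex b {t = t} x∈K y∈K 0≤t t≤1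
    with cone-isCone b x∈K (≤⇒0≤- t≤1) | cone-isCone b y∈K 0≤t
  ... | c , 0≤c , x≋bc | c′ , 0≤c′ , y≋bc′ =
    c +ᵥ c′ , (λ i → +-nonNeg (0≤c i) (0≤c′ i)) ,
    λ k → trans (+-cong (x≋bc k) (y≋bc′ k)) (sym (⟨⟩-+ (λ i → b i k) c c′))

  -- Affine weights may be negative, so the coordinates found here have arbitrary sign;
  -- `cone-relint` shows that they are non-negative near an interior point.
  aff-cone : {b : Fin d → ℝ^ n} → ∀ {y} → y ∈ aff (cone b) → ∃[ c ] y ≋ combination b c
  aff-cone {b = b} {y} (k , p , θ , p∈K , _ , y≋pθ) = combination c θ , λ j → begin
    y j                                              ≈⟨ y≋pθ j ⟩
    combination p θ j                                ≈⟨ ⟨⟩-congʳ θ (λ i → proj₂ (proj₂ (p∈K i)) j) ⟩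
    combination (λ i → combination b (c i)) θ j      ≈⟨ combination-assoc b c θ j ⟨
    combination b (combination c θ) j                ∎
    where c = λ i → proj₁ (p∈K i)

  module _ {b : Fin d → ℝ^ n} (g : Fin d → ℝ^ n) (dual : ∀ i j → ⟨ g i , b j ⟩ ≈ e i j) where

    -- The dual family reads off coordinates, which gives both the linear independence of `b` and
    -- the inequalities that cut out `cone b` within its span.
    coordinate : ∀ {x} c → x ≋ combination b c → ∀ i → ⟨ g i , x ⟩ ≈ c i
    coordinate {x} c x≋bc i = begin
      ⟨ g i , x ⟩                             ≈⟨ ⟨⟩-congˡ (g i) x≋bc ⟩
      ⟨ g i , combination b c ⟩               ≈⟨ ⟨⟩-combination (g i) b c ⟩
      ⟨ (λ j → ⟨ g i , b j ⟩) , c ⟩           ≈⟨ ⟨⟩-congʳ c (dual i) ⟩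
      ⟨ e i , c ⟩                             ≈⟨ ⟨⟩-comm (e i) c ⟩
      ⟨ c , e i ⟩                             ≈⟨ ⟨⟩-e c i ⟩
      c i                                     ∎

    cone-hasDimension : HasDimension (cone b) d
    cone-hasDimension = b
      , (λ i → e i , e-nonNeg i , λ k → sym (⟨⟩-e (λ j → b j k) i))
      , (λ c bc≋0 i → trans (sym (coordinate c (λ _ → refl) i)) (trans (⟨⟩-congˡ (g i) bc≋0) (⟨⟩-0 (g i))))
      , λ (c , _ , x≋bc) → c , x≋bc

    -- Each functional `g i` is positive at `x`, hence non-negative on a ball around `x`. On a
    -- common ball, every point of the affine hull therefore has non-negative coordinates.
    cone-relint : ∀ {x c} → (∀ i → 0# < c i) → x ≋ combination b c → x ∈ relint (cone b)
    cone-relint {x} {c} 0<c x≋bc = (c , proj₁ ∘ 0<c , x≋bc) , δ , proj₁ (proj₂ near) , inside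
      where
      near : Eventually (λ t → ∀ i z → ⟨ z -ᵥ x , z -ᵥ x ⟩ < t * t → 0# ≤ ⟨ g i , z ⟩)
      near = eventually-∀ (λ i → nonNeg-near (g i) x (<-respʳ (sym (coordinate {x} c x≋bc i)) (0<c i)))
      δ = proj₁ near
      inside : ∀ y → y ∈ aff (cone b) → ⟨ y -ᵥ x , y -ᵥ x ⟩ < δ * δ → y ∈ cone b
      inside y y∈aff y-near = let c , y≋bc = aff-cone y∈aff in
        c , (λ i → ≤-respʳ (coordinate {y} c y≋bc i)
               (proj₂ (proj₂ near) (proj₁ (proj₁ (proj₂ near))) ≤-refl i y y-near)) , y≋bc

  -- Positive homogeneity of the support function. The factor 0 is included because the cone in
  -- `no-decomposition` contains its apex.
  support-scale : {X : Pred (ℝ^ n) 0ℓ} → Satisfiable X → ∀ {y z r s} → Support X y s →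
    0# ≤ r → z ≋ r ·ᵥ y → Support X z (r * s)
  support-scale {X = X} (x₀ , x₀∈X) {y} {z} {r} {s} (upper , least) 0≤r z≋ry =
    upper′ , least′
    where
    scale : ∀ x → ⟨ z , x ⟩ ≈ r * ⟨ y , x ⟩
    scale x = begin
      ⟨ z , x ⟩           ≈⟨ ⟨⟩-congʳ x z≋ry ⟩
      ⟨ r ·ᵥ y , x ⟩      ≈⟨ ⟨⟩-comm _ x ⟩
      ⟨ x , r ·ᵥ y ⟩      ≈⟨ ⟨⟩-· x r y ⟩
      r * ⟨ x , y ⟩       ≈⟨ *-congˡ (⟨⟩-comm x y) ⟩
      r * ⟨ y , x ⟩       ∎

    upper′ : ∀ {v} → ∃[ x ] x ∈ X × v ≈ ⟨ z , x ⟩ → v ≤ r * s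
    upper′ (x , x∈X , v≈zx) = ≤-respˡ (sym (trans v≈zx (scale x)))
      (*-monoˡ-≤ 0≤r (upper (x , x∈X , refl)))

    least′ : ∀ {u} → (∀ {v} → ∃[ x ] x ∈ X × v ≈ ⟨ z , x ⟩ → v ≤ u) → r * s ≤ u
    least′ {u} bound with r ≟ 0#
    -- All values `⟨ z , x ⟩` are 0 here; the point `x₀` of `X` ensures that 0 is attained, so no
    -- upper bound is smaller.
    ... | yes r≈0 = ≤-respˡ (begin
          ⟨ z , x₀ ⟩       ≈⟨ scale x₀ ⟩
          r * ⟨ y , x₀ ⟩   ≈⟨ *-congʳ r≈0 ⟩
          0# * ⟨ y , x₀ ⟩  ≈⟨ zeroˡ _ ⟩
          0#               ≈⟨ zeroˡ _ ⟨
          0# * s           ≈⟨ *-congʳ r≈0 ⟨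
          r * s            ∎) (bound (x₀ , x₀∈X , refl))
    ... | no r≉0 with inverse-pos (0≤r , λ 0≈r → r≉0 (sym 0≈r))
    -- Since `u` bounds the values for `z`, the scalar `r⁻¹ * u` bounds those for `y`, and so it is
    -- at least `s`.
    ...   | r⁻¹ , (0≤r⁻¹ , _) , rr⁻¹≈1 = ≤-respʳ (begin
          r * (r⁻¹ * u)    ≈⟨ *-assoc r r⁻¹ u ⟨
          r * r⁻¹ * u      ≈⟨ *-congʳ rr⁻¹≈1 ⟩
          1# * u           ≈⟨ *-identityˡ u ⟩
          u                ∎)
      (*-monoˡ-≤ 0≤r (least λ (x , x∈X , v≈yx) → ≤-respˡ (begin
          r⁻¹ * ⟨ z , x ⟩        ≈⟨ *-congˡ (scale x) ⟩
          r⁻¹ * (r * ⟨ y , x ⟩)  ≈⟨ solve 3 (λ a b c → a :* (b :* c) := (b :* a) :* c) refl r⁻¹ r ⟨ y , x ⟩ ⟩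
          r * r⁻¹ * ⟨ y , x ⟩    ≈⟨ *-congʳ rr⁻¹≈1 ⟩
          1# * ⟨ y , x ⟩         ≈⟨ *-identityˡ _ ⟩
          ⟨ y , x ⟩              ≈⟨ v≈yx ⟨
          _                      ∎) (*-monoˡ-≤ 0≤r⁻¹ (bound (x , x∈X , refl)))))

  support-cong : {X : Pred (ℝ^ n) 0ℓ} → ∀ {y s s′} → s ≈ s′ → Support X y s → Support X y s′
  support-cong s≈s′ (upper , least) = (λ v → ≤-respʳ s≈s′ (upper v)) , (λ bound → ≤-respˡ s≈s′ (least bound))

  N-combination : ∀ (𝒜 : Fin m → ℝ^ n) {β} {b : Fin d → ℝ^ m} {c} →
    (∀ i → b i ∈ N 𝒜 β) → (∀ i → 0# ≤ c i) → ∀ {x} → x ≋ combination b c → x ∈ N 𝒜 β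
  N-combination 𝒜 {b = b} {c} b∈N 0≤c {x} x≋bc =
    (λ k k≢β → ≤-respʳ (sym (x≋bc k)) (⟨⟩-nonNeg (λ i → proj₁ (b∈N i) k k≢β) 0≤c)) ,
    (begin
      _                                    ≈⟨ sum≈⟨1,⟩ x ⟩
      ⟨ (λ _ → 1#) , x ⟩                   ≈⟨ ⟨⟩-congˡ _ x≋bc ⟩
      ⟨ (λ _ → 1#) , combination b c ⟩     ≈⟨ ⟨⟩-combination _ b c ⟩
      ⟨ (λ i → ⟨ (λ _ → 1#) , b i ⟩) , c ⟩ ≈⟨ ⟨⟩-congʳ c (λ i → trans (sym (sum≈⟨1,⟩ (b i))) (proj₂ (b∈N i))) ⟩
      ⟨ 0ᵥ , c ⟩                           ≈⟨ ⟨⟩-comm 0ᵥ c ⟩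
      ⟨ c , 0ᵥ ⟩                           ≈⟨ ⟨⟩-0 c ⟩
      0#                                   ∎)

  module _ {X : Pred (ℝ^ n) 0ℓ} (nonEmpty : Satisfiable X) (𝒜 : Fin m → ℝ^ n)
           {β : Fin m} {ν : ℝ^ m} (circuit : IsCircuit 𝒜 X β ν) where
    open IsCircuit circuit

    -- If all 𝒜 bᵢ are non-negative multiples of 𝒜 ν, then σ_X(- 𝒜 ·) is linear
    -- on the cone of b, as σ_X is positively homogeneous.
    no-decomposition : (b g : Fin 2 → ℝ^ m) → (∀ i j → ⟨ g i , b j ⟩ ≈ e i j) →
      (∀ i → b i ∈ N 𝒜 β) → (ρ : ℝ^ 2) → (∀ i → 0# ≤ ρ i) →
      (∀ i → combination 𝒜 (b i) ≋ ρ i ·ᵥ combination 𝒜 ν) →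
      (c : ℝ^ 2) → (∀ i → 0# < c i) → ¬ ν ≋ combination b c
    no-decomposition b g dual b∈N ρ 0≤ρ 𝒜b≋ρ𝒜ν c 0<c ν≋bc =
      irreducible (cone b) (cone-respects b) (cone-isConvex b) (cone-isCone b)
        (cone-hasDimension g dual) (λ (c , 0≤c , x≋bc) → N-combination 𝒜 b∈N 0≤c x≋bc)
        (⟨ h ,_⟩ , ⟨⟩-isLinear h , linear) (cone-relint g dual 0<c ν≋bc)
      where
      s = proj₁ finite
      -- By duality, ⟨h, bᵢ⟩ = s ρᵢ, which is the value of σ_X at - 𝒜 bᵢ; thus `⟨ h ,_⟩` is the
      -- required linear function.
      h = combination g (s ·ᵥ ρ)

      value : ∀ {x} c → x ≋ combination b c → ⟨ h , x ⟩ ≈ ⟨ ρ , c ⟩ * s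
      value {x} c x≋bc = begin
        ⟨ h , x ⟩                             ≈⟨ ⟨⟩-comm h x ⟩
        ⟨ x , h ⟩                             ≈⟨ ⟨⟩-combination x g (s ·ᵥ ρ) ⟩
        ⟨ (λ i → ⟨ x , g i ⟩) , s ·ᵥ ρ ⟩
          ≈⟨ ⟨⟩-congʳ (s ·ᵥ ρ) (λ i → trans (⟨⟩-comm x (g i)) (coordinate g dual c x≋bc i)) ⟩
        ⟨ c , s ·ᵥ ρ ⟩                        ≈⟨ ⟨⟩-· c s ρ ⟩
        s * ⟨ c , ρ ⟩                         ≈⟨ *-comm s _ ⟩
        ⟨ c , ρ ⟩ * s                         ≈⟨ *-congʳ (⟨⟩-comm c ρ) ⟩
        ⟨ ρ , c ⟩ * s                         ∎

      𝒜x≋ρc𝒜ν : ∀ {x} c → x ≋ combination b c → combination 𝒜 x ≋ ⟨ ρ , c ⟩ ·ᵥ combination 𝒜 ν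
      𝒜x≋ρc𝒜ν {x} c x≋bc k = begin
        combination 𝒜 x k                                         ≈⟨ ⟨⟩-congˡ (λ i → 𝒜 i k) x≋bc ⟩
        combination 𝒜 (combination b c) k                         ≈⟨ combination-assoc 𝒜 b c k ⟩
        combination (λ i → combination 𝒜 (b i)) c k
          ≈⟨ ⟨⟩-congʳ c (λ i → trans (𝒜b≋ρ𝒜ν i k) (*-comm _ _)) ⟩
        ⟨ combination 𝒜 ν k ·ᵥ ρ , c ⟩                            ≈⟨ ⟨⟩-comm (combination 𝒜 ν k ·ᵥ ρ) c ⟩
        ⟨ c , combination 𝒜 ν k ·ᵥ ρ ⟩                            ≈⟨ ⟨⟩-· c _ ρ ⟩
        combination 𝒜 ν k * ⟨ c , ρ ⟩                             ≈⟨ *-comm _ _ ⟩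
        ⟨ c , ρ ⟩ * combination 𝒜 ν k                             ≈⟨ *-congʳ (⟨⟩-comm c ρ) ⟩
        ⟨ ρ , c ⟩ * combination 𝒜 ν k                             ∎

      linear : ∀ {x} → x ∈ cone b → Support X (-ᵥ combination 𝒜 x) ⟨ h , x ⟩
      linear {x} (c , 0≤c , x≋bc) = support-cong (sym (value c x≋bc))
        (support-scale nonEmpty (proj₂ finite) (⟨⟩-nonNeg 0≤ρ 0≤c) λ k → trans
          (-‿cong (𝒜x≋ρc𝒜ν c x≋bc k))
          (solve 2 (λ a b → :- (a :* b) := a :* :- b) refl ⟨ ρ , c ⟩ (combination 𝒜 ν k)))

  -- Circuits

  -- A convex combination comes as a list of points, possibly with repetitions. Collecting the
  -- weights of all points with the same index gives a vector in `ℝ^ m`, comparable with `ν`.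
  conv-indices : (𝒜 : Fin m → ℝ^ n) (P : Pred (Fin m) 0ℓ) → ∀ {y} →
    y ∈ conv (λ α → ∃[ i ] P i × α ≋ 𝒜 i) →
    ∃[ θ ] (∀ i → 0# ≤ θ i) × sum θ ≈ 1# × y ≋ combination 𝒜 θ × (∀ i → ¬ P i → θ i ≈ 0#)
  conv-indices 𝒜 P {y} (k , p , θ , p∈ , 0≤θ , sumθ≈1 , y≋pθ) =
    θ′ , (λ l → ⟨⟩-nonNeg (λ i → e-nonNeg (index i) l) 0≤θ) , sumθ′≈1 , y≋𝒜θ′ , vanish
    where
    index = λ i → proj₁ (p∈ i)
    θ′ = combination (λ i → e (index i)) θ

    push : ∀ x → ⟨ x , θ′ ⟩ ≈ ⟨ (λ i → x (index i)) , θ ⟩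
    push x = trans (⟨⟩-combination x (λ i → e (index i)) θ) (⟨⟩-congʳ θ (λ i → ⟨⟩-e x (index i)))

    sumθ′≈1 : sum θ′ ≈ 1#
    sumθ′≈1 = begin
      sum θ′                  ≈⟨ sum≈⟨1,⟩ θ′ ⟩
      ⟨ (λ _ → 1#) , θ′ ⟩     ≈⟨ push (λ _ → 1#) ⟩
      ⟨ (λ _ → 1#) , θ ⟩      ≈⟨ sum≈⟨1,⟩ θ ⟨
      sum θ                   ≈⟨ sumθ≈1 ⟩
      1#                      ∎

    y≋𝒜θ′ : y ≋ combination 𝒜 θ′
    y≋𝒜θ′ j = begin
      y j                                ≈⟨ y≋pθ j ⟩
      combination p θ j                  ≈⟨ ⟨⟩-congʳ θ (λ i → proj₂ (proj₂ (p∈ i)) j) ⟩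
      ⟨ (λ i → 𝒜 (index i) j) , θ ⟩      ≈⟨ push (λ i → 𝒜 i j) ⟨
      combination 𝒜 θ′ j                 ∎

    vanish : ∀ l → ¬ P l → θ′ l ≈ 0#
    vanish l ¬Pl = begin
      ⟨ (λ i → e (index i) l) , θ ⟩  ≈⟨ ⟨⟩-congʳ θ (λ i → reflexive
                                          (e-off λ eq → ¬Pl (≡.subst P eq (proj₁ (proj₂ (p∈ i)))))) ⟩
      ⟨ 0ᵥ , θ ⟩                     ≈⟨ ⟨⟩-comm 0ᵥ θ ⟩
      ⟨ θ , 0ᵥ ⟩                     ≈⟨ ⟨⟩-0 θ ⟩
      0#                             ∎

  half : ∃[ h ] 0# < h × (1# + 1#) * h ≈ 1#
  half = inverse-pos 0<2

  -- The signs in ν ± δ μ, so that one formula covers both generators of the cone.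
  sign : Fin 2 → ℝ
  sign zero    = 1#
  sign (suc _) = - 1#

  module _ {X : Pred (ℝ^ n) 0ℓ} (nonEmpty : Satisfiable X) (𝒜 : Fin m → ℝ^ n)
           {β : Fin m} {ν : ℝ^ m} (circuit : IsCircuit 𝒜 X β ν) (νβ≈-1 : ν β ≈ - 1#) where
    open IsCircuit circuit

    νβ≉0 : ¬ ν β ≈ 0#
    νβ≉0 νβ≈0 = 0≉1 (begin
      0#         ≈⟨ solve 0 (con (+ 0) := :- con (+ 0)) refl ⟩
      - 0#       ≈⟨ -‿cong νβ≈0 ⟨
      - ν β      ≈⟨ -‿cong νβ≈-1 ⟩
      - - 1#     ≈⟨ solve 0 (:- :- con (+ 1) := con (+ 1)) refl ⟩
      1#         ∎)

    -- Otherwise ν = b₀ + b₁ for the linearly independent vectors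
    -- b₀, b₁ = (ν ± δ μ) / 2, whose images under 𝒜 are multiples of 𝒜 ν.
    no-perturbation : (μ : ℝ^ m) (a : ℝ) → μ β ≈ 0# → sum μ ≈ 0# →
      combination 𝒜 μ ≋ a ·ᵥ combination 𝒜 ν → (∀ i → ν i ≈ 0# → μ i ≈ 0#) → μ ≋ 0ᵥ
    no-perturbation μ a μβ≈0 sumμ≈0 𝒜μ≋a𝒜ν μ⊂ν i with μ i ≟ 0#
    ... | yes μi≈0 = μi≈0
    -- The entries at `β` and `i` witness that `ν` and `μ` are independent: `ν β ≈ - 1#` and
    -- `μ β ≈ 0#`, while `μ i` is non-zero.
    ... | no  μi≉0 = contradiction ν≋b (no-decomposition nonEmpty 𝒜 circuit b g dual b∈N ρ 0≤ρ 𝒜b≋ρ𝒜ν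
                       (λ _ → 1#) (λ _ → 0<1))
      where
      w = proj₁ (inverse μi≉0)
      h = proj₁ half
      0≤h = proj₁ (proj₁ (proj₂ half))

      -- The first family of inequalities keeps ν ± t μ in `N 𝒜 β`; the second makes the factors `ρ`
      -- non-negative.
      small : Eventually (λ t → (∀ j k → k ≢ β → 0# ≤ ν k + t * (sign j * μ k)) ×
                                (∀ j → 0# ≤ 1# + t * (sign j * a)))
      small = eventually-×
        (eventually-∀ λ j → eventually-∀ λ k → off-β j k)
        (eventually-∀ λ j → eventually-affine-nonNeg (sign j * a) 0<1)
        where
        off-β : ∀ j k → Eventually (λ t → k ≢ β → 0# ≤ ν k + t * (sign j * μ k))
        off-β j k with k Fin.≟ β
        ... | yes k≡β = 1# , 0<1 , λ _ _ k≢β → contradiction k≡β k≢β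
        ... | no  k≢β with eventually-affine-nonNeg₀ {y = sign j * μ k} (proj₁ ν*∈N k k≢β)
                             (λ νk≈0 → trans (*-congˡ (μ⊂ν k νk≈0)) (zeroʳ (sign j)))
        ...   | δ , 0<δ , p = δ , 0<δ , λ 0≤t t≤δ _ → p 0≤t t≤δ

      δ = proj₁ small
      0<δ = proj₁ (proj₂ small)
      small-δ = proj₂ (proj₂ small) (proj₁ 0<δ) ≤-refl
      δ⁻¹ = proj₁ (inverse-pos 0<δ)
      δδ⁻¹≈1 = proj₂ (proj₂ (inverse-pos 0<δ))

      -- The functionals x ↦ - x β and x ↦ (x i + ν i * x β) / μ i are dual to ν, μ.
      b g : Fin 2 → ℝ^ m
      b j = h ·ᵥ (ν +ᵥ (δ * sign j) ·ᵥ μ)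
      g j = -ᵥ e β +ᵥ (sign j * (w * δ⁻¹)) ·ᵥ (e i +ᵥ ν i ·ᵥ e β)

      ρ : ℝ^ 2
      ρ j = h * (1# + δ * (sign j * a))

      0≤ρ : ∀ j → 0# ≤ ρ j
      0≤ρ j = *-nonNeg 0≤h (proj₂ small-δ j)

      eval-b : ∀ x j → ⟨ x , b j ⟩ ≈ h * (⟨ x , ν ⟩ + δ * sign j * ⟨ x , μ ⟩)
      eval-b x j = begin
        ⟨ x , b j ⟩                                       ≈⟨ ⟨⟩-· x h _ ⟩
        h * ⟨ x , ν +ᵥ (δ * sign j) ·ᵥ μ ⟩                ≈⟨ *-congˡ (⟨⟩-+ x ν ((δ * sign j) ·ᵥ μ)) ⟩
        h * (⟨ x , ν ⟩ + ⟨ x , (δ * sign j) ·ᵥ μ ⟩)       ≈⟨ *-congˡ (+-congˡ (⟨⟩-· x (δ * sign j) μ)) ⟩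
        h * (⟨ x , ν ⟩ + δ * sign j * ⟨ x , μ ⟩)          ∎

      eval-g : ∀ x j → ⟨ g j , x ⟩ ≈ - x β + sign j * (w * δ⁻¹) * (x i + ν i * x β)
      eval-g x j = begin
        ⟨ g j , x ⟩
          ≈⟨ ⟨⟩-comm (g j) x ⟩
        ⟨ x , g j ⟩
          ≈⟨ ⟨⟩-+ x (-ᵥ e β) _ ⟩
        ⟨ x , -ᵥ e β ⟩ + ⟨ x , (sign j * (w * δ⁻¹)) ·ᵥ (e i +ᵥ ν i ·ᵥ e β) ⟩
          ≈⟨ +-cong (⟨⟩-neg x (e β)) (⟨⟩-· x _ (e i +ᵥ ν i ·ᵥ e β)) ⟩
        - ⟨ x , e β ⟩ + sign j * (w * δ⁻¹) * ⟨ x , e i +ᵥ ν i ·ᵥ e β ⟩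
          ≈⟨ +-cong (-‿cong (⟨⟩-e x β)) (*-congˡ (⟨⟩-+ x (e i) (ν i ·ᵥ e β))) ⟩
        - x β + sign j * (w * δ⁻¹) * (⟨ x , e i ⟩ + ⟨ x , ν i ·ᵥ e β ⟩)
          ≈⟨ +-congˡ (*-congˡ (+-cong (⟨⟩-e x i) (trans (⟨⟩-· x (ν i) (e β)) (*-congˡ (⟨⟩-e x β))))) ⟩
        - x β + sign j * (w * δ⁻¹) * (x i + ν i * x β)
          ∎

      b∈N : ∀ j → b j ∈ N 𝒜 β
      b∈N j = (λ k k≢β → *-nonNeg 0≤h (≤-respʳ
          (solve 4 (λ x t s y → x :+ t :* (s :* y) := x :+ t :* s :* y) refl (ν k) δ (sign j) (μ k))
          (proj₁ small-δ j k k≢β)))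
        , (begin
        sum (b j)
          ≈⟨ sum≈⟨1,⟩ (b j) ⟩
        ⟨ (λ _ → 1#) , b j ⟩
          ≈⟨ eval-b (λ _ → 1#) j ⟩
        h * (⟨ (λ _ → 1#) , ν ⟩ + δ * sign j * ⟨ (λ _ → 1#) , μ ⟩)
          ≈⟨ *-congˡ (+-cong (trans (sym (sum≈⟨1,⟩ ν)) (proj₂ ν*∈N))
               (*-congˡ (trans (sym (sum≈⟨1,⟩ μ)) sumμ≈0))) ⟩
        h * (0# + δ * sign j * 0#)
          ≈⟨ solve 2 (λ h t → h :* (con (+ 0) :+ t :* con (+ 0)) := con (+ 0)) refl h (δ * sign j) ⟩
        0#
          ∎)

      𝒜b≋ρ𝒜ν : ∀ j → combination 𝒜 (b j) ≋ ρ j ·ᵥ combination 𝒜 ν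
      𝒜b≋ρ𝒜ν j k = begin
        combination 𝒜 (b j) k
          ≈⟨ eval-b (λ l → 𝒜 l k) j ⟩
        h * (combination 𝒜 ν k + δ * sign j * combination 𝒜 μ k)
          ≈⟨ *-congˡ (+-congˡ (*-congˡ (𝒜μ≋a𝒜ν k))) ⟩
        h * (combination 𝒜 ν k + δ * sign j * (a * combination 𝒜 ν k))
          ≈⟨ solve 5 (λ h x d s a → h :* (x :+ d :* s :* (a :* x)) := h :* (con (+ 1) :+ d :* (s :* a)) :* x)
               refl h (combination 𝒜 ν k) δ (sign j) a ⟩
        ρ j * combination 𝒜 ν k
          ∎

      -- For the functionals ν′, μ′ dual to ν, μ, the pairing of ν′ + sⱼ δ⁻¹ μ′ with h (ν + sₗ δ μ)
      -- is h (1 + sⱼ sₗ): 1 for equal signs and 0 for opposite ones.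
      dual′ : ∀ j l → ⟨ g j , b l ⟩ ≈ h * (1# + sign j * sign l)
      dual′ j l = begin
        ⟨ g j , b l ⟩
          ≈⟨ eval-b (g j) l ⟩
        h * (⟨ g j , ν ⟩ + δ * sign l * ⟨ g j , μ ⟩)
          ≈⟨ *-congˡ (+-cong (eval-g ν j) (*-congˡ (eval-g μ j))) ⟩
        h * ((- ν β + sign j * (w * δ⁻¹) * (ν i + ν i * ν β))
          + δ * sign l * (- μ β + sign j * (w * δ⁻¹) * (μ i + ν i * μ β)))
          ≈⟨ *-congˡ (+-cong
               (+-cong (-‿cong νβ≈-1) (*-congˡ (+-congˡ (*-congˡ νβ≈-1))))
               (*-congˡ (+-cong (-‿cong μβ≈0) (*-congˡ (+-congˡ (*-congˡ μβ≈0)))))) ⟩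
        h * ((- - 1# + sign j * (w * δ⁻¹) * (ν i + ν i * - 1#))
          + δ * sign l * (- 0# + sign j * (w * δ⁻¹) * (μ i + ν i * 0#)))
          ≈⟨ solve 8 (λ h s s′ w d d⁻¹ x y →
               h :* ((:- :- con (+ 1) :+ s :* (w :* d⁻¹) :* (x :+ x :* :- con (+ 1)))
                 :+ d :* s′ :* (:- con (+ 0) :+ s :* (w :* d⁻¹) :* (y :+ x :* con (+ 0))))
               := h :* (con (+ 1) :+ (d :* d⁻¹) :* (y :* w) :* (s :* s′)))
               refl h (sign j) (sign l) w δ δ⁻¹ (ν i) (μ i) ⟩
        h * (1# + (δ * δ⁻¹) * (μ i * w) * (sign j * sign l))
          ≈⟨ *-congˡ (+-congˡ (*-congʳ (trans (*-cong δδ⁻¹≈1 (proj₂ (inverse μi≉0))) (*-identityˡ 1#)))) ⟩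
        h * (1# + 1# * (sign j * sign l))
          ≈⟨ *-congˡ (+-congˡ (*-identityˡ _)) ⟩
        h * (1# + sign j * sign l)
          ∎

      dual : ∀ j l → ⟨ g j , b l ⟩ ≈ e j l
      dual zero zero = trans (dual′ zero zero) (trans
        (solve 1 (λ h → h :* (con (+ 1) :+ con (+ 1) :* con (+ 1)) := (con (+ 1) :+ con (+ 1)) :* h) refl h)
        (proj₂ (proj₂ half)))
      dual zero (suc zero) = trans (dual′ zero (suc zero))
        (solve 1 (λ h → h :* (con (+ 1) :+ con (+ 1) :* :- con (+ 1)) := con (+ 0)) refl h)
      dual (suc zero) zero = trans (dual′ (suc zero) zero)
        (solve 1 (λ h → h :* (con (+ 1) :+ :- con (+ 1) :* con (+ 1)) := con (+ 0)) refl h)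
      dual (suc zero) (suc zero) = trans (dual′ (suc zero) (suc zero)) (trans
        (solve 1 (λ h → h :* (con (+ 1) :+ :- con (+ 1) :* :- con (+ 1)) := (con (+ 1) :+ con (+ 1)) :* h) refl h)
        (proj₂ (proj₂ half)))

      ν≋b : ν ≋ combination b (λ _ → 1#)
      ν≋b k = begin
        ν k
          ≈⟨ *-identityˡ (ν k) ⟨
        1# * ν k
          ≈⟨ *-congʳ (proj₂ (proj₂ half)) ⟨
        (1# + 1#) * h * ν k
          ≈⟨ solve 4 (λ h x d y → (con (+ 1) :+ con (+ 1)) :* h :* x
               := h :* (x :+ d :* con (+ 1) :* y) :* con (+ 1)
                  :+ (h :* (x :+ d :* :- con (+ 1) :* y) :* con (+ 1) :+ con (+ 0)))
               refl h (ν k) δ (μ k) ⟩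
        combination b (λ _ → 1#) k
          ∎

    -- Adding `κ β ·ᵥ ν` to `κ` cancels the entry at `β`, as `ν β ≈ - 1#`. Since 𝒜 κ = 0, the image
    -- of the result under 𝒜 is κ_β 𝒜 ν, so `no-perturbation` applies with `a = κ β`.
    dependence-unique : (κ : ℝ^ m) → sum κ ≈ 0# → combination 𝒜 κ ≋ 0ᵥ →
      (∀ i → ν i ≈ 0# → κ i ≈ 0#) → ∀ i → κ i + κ β * ν i ≈ 0#
    dependence-unique κ sumκ≈0 𝒜κ≋0 κ⊂ν = no-perturbation μ a μβ≈0 sumμ≈0 𝒜μ≋a𝒜ν μ⊂ν
      where
      a = κ β
      μ = κ +ᵥ a ·ᵥ ν

      eval-μ : ∀ x → ⟨ x , μ ⟩ ≈ ⟨ x , κ ⟩ + a * ⟨ x , ν ⟩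
      eval-μ x = trans (⟨⟩-+ x κ (a ·ᵥ ν)) (+-congˡ (⟨⟩-· x a ν))

      μβ≈0 : μ β ≈ 0#
      μβ≈0 = trans (+-congˡ (*-congˡ νβ≈-1)) (solve 1 (λ a → a :+ a :* :- con (+ 1) := con (+ 0)) refl a)

      sumμ≈0 : sum μ ≈ 0#
      sumμ≈0 = begin
        sum μ                                               ≈⟨ sum≈⟨1,⟩ μ ⟩
        ⟨ (λ _ → 1#) , μ ⟩                                  ≈⟨ eval-μ (λ _ → 1#) ⟩
        ⟨ (λ _ → 1#) , κ ⟩ + a * ⟨ (λ _ → 1#) , ν ⟩
          ≈⟨ +-cong (trans (sym (sum≈⟨1,⟩ κ)) sumκ≈0) (*-congˡ (trans (sym (sum≈⟨1,⟩ ν)) (proj₂ ν*∈N))) ⟩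
        0# + a * 0#
          ≈⟨ solve 1 (λ a → con (+ 0) :+ a :* con (+ 0) := con (+ 0)) refl a ⟩
        0#                                                  ∎

      𝒜μ≋a𝒜ν : combination 𝒜 μ ≋ a ·ᵥ combination 𝒜 ν
      𝒜μ≋a𝒜ν k = trans (eval-μ (λ l → 𝒜 l k)) (trans (+-congʳ (𝒜κ≋0 k)) (+-identityˡ _))

      μ⊂ν : ∀ i → ν i ≈ 0# → μ i ≈ 0#
      μ⊂ν i νi≈0 = trans (+-cong (κ⊂ν i νi≈0) (trans (*-congˡ νi≈0) (zeroʳ a))) (+-identityˡ 0#)

    -- Applying 𝒜 to κ + κ_β ν = 0 leaves κ_β 𝒜 ν = 0, and κ_β can be cancelled.
    combination≈0 : (κ : ℝ^ m) → sum κ ≈ 0# → combination 𝒜 κ ≋ 0ᵥ →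
      (∀ i → ν i ≈ 0# → κ i ≈ 0#) → ¬ κ β ≈ 0# → combination 𝒜 ν ≋ 0ᵥ
    combination≈0 κ sumκ≈0 𝒜κ≋0 κ⊂ν κβ≉0 k with inverse κβ≉0
    ... | c , κβc≈1 = begin
      combination 𝒜 ν k
        ≈⟨ *-identityˡ _ ⟨
      1# * combination 𝒜 ν k
        ≈⟨ *-congʳ κβc≈1 ⟨
      κ β * c * combination 𝒜 ν k
        ≈⟨ solve 3 (λ a c x → a :* c :* x := c :* (con (+ 0) :+ a :* x)) refl (κ β) c (combination 𝒜 ν k) ⟩
      c * (0# + κ β * combination 𝒜 ν k)
        ≈⟨ *-congˡ (+-cong (𝒜κ≋0 k) (⟨⟩-· (λ l → 𝒜 l k) (κ β) ν)) ⟨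
      c * (combination 𝒜 κ k + combination 𝒜 (κ β ·ᵥ ν) k)
        ≈⟨ *-congˡ (⟨⟩-+ (λ l → 𝒜 l k) κ (κ β ·ᵥ ν)) ⟨
      c * combination 𝒜 (κ +ᵥ κ β ·ᵥ ν) k
        ≈⟨ *-congˡ (trans (⟨⟩-congˡ (λ l → 𝒜 l k) (dependence-unique κ sumκ≈0 𝒜κ≋0 κ⊂ν)) (⟨⟩-0 (λ l → 𝒜 l k))) ⟩
      c * 0#
        ≈⟨ zeroʳ c ⟩
      0#
        ∎

    -- Convex hulls of the support of a circuit

    0<ν⇒≢β : ∀ {i} → 0# < ν i → i ≢ β
    0<ν⇒≢β 0<νβ ≡.refl = ¬0<-1 (<-respʳ νβ≈-1 0<νβ)

    β∈conv⇒combination≈0 : 𝒜 β ∈ conv (_⁺ 𝒜 ν) → combination 𝒜 ν ≋ 0ᵥ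
    β∈conv⇒combination≈0 β∈conv with conv-indices 𝒜 (λ i → 0# < ν i) β∈conv
    ... | θ , _ , sumθ≈1 , 𝒜β≋𝒜θ , θ⊂ν⁺ = combination≈0 κ sumκ≈0 𝒜κ≋0 κ⊂ν κβ≉0
      where
      κ = e β -ᵥ θ

      eval-κ : ∀ x → ⟨ x , κ ⟩ ≈ x β - ⟨ x , θ ⟩
      eval-κ x = trans (⟨⟩-+ x (e β) (-ᵥ θ)) (+-cong (⟨⟩-e x β) (⟨⟩-neg x θ))

      sumκ≈0 : sum κ ≈ 0#
      sumκ≈0 = begin
        sum κ                             ≈⟨ sum≈⟨1,⟩ κ ⟩
        ⟨ (λ _ → 1#) , κ ⟩                ≈⟨ eval-κ (λ _ → 1#) ⟩
        1# - ⟨ (λ _ → 1#) , θ ⟩           ≈⟨ +-congˡ (-‿cong (trans (sym (sum≈⟨1,⟩ θ)) sumθ≈1)) ⟩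
        1# - 1#                           ≈⟨ -‿inverseʳ 1# ⟩
        0#                                ∎

      𝒜κ≋0 : combination 𝒜 κ ≋ 0ᵥ
      𝒜κ≋0 l = begin
        combination 𝒜 κ l                 ≈⟨ eval-κ (λ i → 𝒜 i l) ⟩
        𝒜 β l - combination 𝒜 θ l         ≈⟨ +-congˡ (-‿cong (𝒜β≋𝒜θ l)) ⟨
        𝒜 β l - 𝒜 β l                     ≈⟨ -‿inverseʳ _ ⟩
        0#                                ∎

      κ⊂ν : ∀ i → ν i ≈ 0# → κ i ≈ 0#
      κ⊂ν i νi≈0 = begin
        e β i - θ i     ≈⟨ +-cong (reflexive (e-off {i = β} {i} λ { ≡.refl → νβ≉0 νi≈0 }))
                                  (-‿cong (θ⊂ν⁺ i λ 0<νi → <⇒≉0 0<νi νi≈0)) ⟩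
        0# - 0#         ≈⟨ -‿inverseʳ 0# ⟩
        0#              ∎

      -- The weights `θ` live on positive entries of `ν` and so vanish at `β`; hence κ_β = 1.
      κβ≉0 : ¬ κ β ≈ 0#
      κβ≉0 κβ≈0 = 0≉1 (trans (sym κβ≈0) (begin
        e β β - θ β     ≈⟨ +-cong (reflexive (e-diag β)) (-‿cong (θ⊂ν⁺ β λ 0<νβ → 0<ν⇒≢β 0<νβ ≡.refl)) ⟩
        1# - 0#         ≈⟨ solve 0 (con (+ 1) :- con (+ 0) := con (+ 1)) refl ⟩
        1#              ∎))

    relint-disjoint : Injective _≡_ _≋_ 𝒜 → Empty (relint (conv (supp 𝒜 ν)) ∩ (_⁺ 𝒜 ν))
    relint-disjoint injective x ((_ , ε , 0<ε , ball) , j , 0<νj , x≋𝒜j) =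
      -- Injectivity would identify `j` with `β`, but `ν` is positive at `j` and negative at `β`.
      j≢β (≡.sym (injective 𝒜β≋𝒜j))
      where
      j≢β = 0<ν⇒≢β 0<νj
      v = 𝒜 j -ᵥ 𝒜 β
      M = ⟨ v , v ⟩
      0<1+M = +-pos 0<1 (norm²-nonNeg v)
      s = proj₁ (inverse-pos 0<1+M)
      -- δ = ε / (1 + |v|²) keeps `y` inside the ball without a square root: with M = |v|², ε² - |δ
      -- v|² = δ² (1 + M + M²), which is positive even if M = 0.
      δ = ε * s
      0<δ = *-pos 0<ε (proj₁ (proj₂ (inverse-pos 0<1+M)))
      y = 𝒜 j +ᵥ δ ·ᵥ v

      y∈aff : y ∈ aff (conv (supp 𝒜 ν))
      y∈aff = 2 , p , c , p∈conv
            , solve 1 (λ d → con (+ 1) :+ d :+ (:- d :+ con (+ 0)) := con (+ 1)) refl δ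
            , λ k → solve 3 (λ a b d → a :+ d :* (a :- b)
                := a :* (con (+ 1) :+ d) :+ (b :* :- d :+ con (+ 0))) refl (𝒜 j k) (𝒜 β k) δ
        where
        p : Fin 2 → ℝ^ n
        p zero    = 𝒜 j
        p (suc _) = 𝒜 β
        c : ℝ^ 2
        c zero    = 1# + δ
        c (suc _) = - δ
        vertex∈conv : ∀ {i} → ¬ ν i ≈ 0# → 𝒜 i ∈ conv (supp 𝒜 ν)
        vertex∈conv {i} νi≉0 = 1 , (λ _ → 𝒜 i) , (λ _ → 1#) , (λ _ → i , νi≉0 , λ _ → refl)
          , (λ _ → 0≤1) , +-identityʳ 1#
          , λ k → solve 1 (λ a → a := a :* con (+ 1) :+ con (+ 0)) refl (𝒜 i k)
        p∈conv : ∀ i → p i ∈ conv (supp 𝒜 ν)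
        p∈conv zero    = vertex∈conv (<⇒≉0 0<νj)
        p∈conv (suc _) = vertex∈conv νβ≉0

      conv-point : y ∈ conv (supp 𝒜 ν)
      conv-point = ball y y∈aff (0<-⇒< (<-respʳ (sym (begin
        ε * ε - ⟨ y -ᵥ x , y -ᵥ x ⟩
          ≈⟨ +-congˡ (-‿cong (trans (⟨⟩-cong y-x≋δv y-x≋δv) (trans (⟨⟩-· (δ ·ᵥ v) δ v)
               (*-congˡ (trans (⟨⟩-comm (δ ·ᵥ v) v) (⟨⟩-· v δ v)))))) ⟩
        ε * ε - δ * (δ * M)
          ≈⟨ +-congʳ (*-cong ε≈δ[1+M] ε≈δ[1+M]) ⟩
        δ * (1# + M) * (δ * (1# + M)) - δ * (δ * M)
          ≈⟨ solve 2 (λ d m → d :* (con (+ 1) :+ m) :* (d :* (con (+ 1) :+ m)) :- d :* (d :* m)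
               := d :* d :* (con (+ 1) :+ (m :+ m :* m))) refl δ M ⟩
        δ * δ * (1# + (M + M * M))
          ∎)) (*-pos (*-pos 0<δ 0<δ) (+-pos 0<1 (+-nonNeg (norm²-nonNeg v) (square-nonNeg M))))))
        where
        y-x≋δv : (y -ᵥ x) ≋ δ ·ᵥ v
        y-x≋δv k = trans (+-congˡ (-‿cong (x≋𝒜j k)))
          (solve 2 (λ a b → a :+ b :- a := b) refl (𝒜 j k) (δ * v k))
        ε≈δ[1+M] : ε ≈ δ * (1# + M)
        ε≈δ[1+M] = begin
          ε                     ≈⟨ *-identityʳ ε ⟨
          ε * 1#                ≈⟨ *-congˡ (proj₂ (proj₂ (inverse-pos 0<1+M))) ⟨
          ε * ((1# + M) * s)    ≈⟨ solve 3 (λ a b c → a :* (b :* c) := a :* c :* b) refl ε (1# + M) s ⟩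
          δ * (1# + M)          ∎

      decomposition = conv-indices 𝒜 (λ i → ¬ ν i ≈ 0#) conv-point
      θ = proj₁ decomposition
      0≤θ = proj₁ (proj₂ decomposition)
      sumθ≈1 = proj₁ (proj₂ (proj₂ decomposition))
      y≋𝒜θ = proj₁ (proj₂ (proj₂ (proj₂ decomposition)))
      θ⊂ν = proj₂ (proj₂ (proj₂ (proj₂ decomposition)))

      κ : ℝ^ m
      κ = θ +ᵥ (δ ·ᵥ e β -ᵥ (1# + δ) ·ᵥ e j)

      eval-κ : ∀ x → ⟨ x , κ ⟩ ≈ ⟨ x , θ ⟩ + (δ * x β - (1# + δ) * x j)
      eval-κ x = begin
        ⟨ x , κ ⟩
          ≈⟨ ⟨⟩-+ x θ _ ⟩
        ⟨ x , θ ⟩ + ⟨ x , δ ·ᵥ e β -ᵥ (1# + δ) ·ᵥ e j ⟩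
          ≈⟨ +-congˡ (⟨⟩-+ x (δ ·ᵥ e β) (-ᵥ ((1# + δ) ·ᵥ e j))) ⟩
        ⟨ x , θ ⟩ + (⟨ x , δ ·ᵥ e β ⟩ + ⟨ x , -ᵥ ((1# + δ) ·ᵥ e j) ⟩)
          ≈⟨ +-congˡ (+-cong (⟨⟩-· x δ (e β))
               (trans (⟨⟩-neg x ((1# + δ) ·ᵥ e j)) (-‿cong (⟨⟩-· x (1# + δ) (e j))))) ⟩
        ⟨ x , θ ⟩ + (δ * ⟨ x , e β ⟩ - (1# + δ) * ⟨ x , e j ⟩)
          ≈⟨ +-congˡ (+-cong (*-congˡ (⟨⟩-e x β)) (-‿cong (*-congˡ (⟨⟩-e x j)))) ⟩
        ⟨ x , θ ⟩ + (δ * x β - (1# + δ) * x j)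
          ∎

      sumκ≈0 : sum κ ≈ 0#
      sumκ≈0 = begin
        sum κ                                                        ≈⟨ sum≈⟨1,⟩ κ ⟩
        ⟨ (λ _ → 1#) , κ ⟩                                           ≈⟨ eval-κ (λ _ → 1#) ⟩
        ⟨ (λ _ → 1#) , θ ⟩ + (δ * 1# - (1# + δ) * 1#)
          ≈⟨ +-congʳ (trans (sym (sum≈⟨1,⟩ θ)) sumθ≈1) ⟩
        1# + (δ * 1# - (1# + δ) * 1#)
          ≈⟨ solve 1 (λ d → con (+ 1) :+ (d :* con (+ 1) :- (con (+ 1) :+ d) :* con (+ 1)) := con (+ 0)) refl δ ⟩
        0#                                                           ∎

      𝒜κ≋0 : combination 𝒜 κ ≋ 0ᵥ
      𝒜κ≋0 k = begin
        combination 𝒜 κ k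
          ≈⟨ eval-κ (λ i → 𝒜 i k) ⟩
        combination 𝒜 θ k + (δ * 𝒜 β k - (1# + δ) * 𝒜 j k)
          ≈⟨ +-congʳ (y≋𝒜θ k) ⟨
        𝒜 j k + δ * (𝒜 j k - 𝒜 β k) + (δ * 𝒜 β k - (1# + δ) * 𝒜 j k)
          ≈⟨ solve 3 (λ a b d → a :+ d :* (a :- b) :+ (d :* b :- (con (+ 1) :+ d) :* a) := con (+ 0))
               refl (𝒜 j k) (𝒜 β k) δ ⟩
        0#
          ∎

      off : ∀ {i} → i ≢ β → i ≢ j → κ i ≈ θ i
      off {i} i≢β i≢j = trans (+-congˡ (+-cong
          (*-congˡ (reflexive (e-off (i≢β ∘ ≡.sym)))) (-‿cong (*-congˡ (reflexive (e-off (i≢j ∘ ≡.sym)))))))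
        (solve 2 (λ t d → t :+ (d :* con (+ 0) :- (con (+ 1) :+ d) :* con (+ 0)) := t) refl (θ i) δ)

      κ⊂ν : ∀ i → ν i ≈ 0# → κ i ≈ 0#
      κ⊂ν i νi≈0 = trans
        (off (λ { ≡.refl → νβ≉0 νi≈0 }) (λ { ≡.refl → <⇒≉0 0<νj νi≈0 }))
        (θ⊂ν i λ νi≉0 → νi≉0 νi≈0)

      0<κβ : 0# < κ β
      0<κβ = <-respʳ (begin
        δ + θ β
          ≈⟨ solve 2 (λ t d → d :+ t := t :+ (d :* con (+ 1) :- (con (+ 1) :+ d) :* con (+ 0))) refl (θ β) δ ⟩
        θ β + (δ * 1# - (1# + δ) * 0#)
          ≈⟨ +-congˡ (+-cong (*-congˡ (reflexive (e-diag β))) (-‿cong (*-congˡ (reflexive (e-off j≢β))))) ⟨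
        κ β                                            ∎) (+-pos 0<δ (0≤θ β))

      -- Away from `β` and `j`, - κ_β νᵢ = κᵢ = θᵢ ≥ 0 with κ_β > 0 gives νᵢ ≤ 0, whereas membership
      -- in `N 𝒜 β` gives νᵢ ≥ 0.
      ν≈0-off : ∀ {i} → i ≢ β → i ≢ j → ν i ≈ 0#
      ν≈0-off {i} i≢β i≢j = ≤-antisym
        (0≤-⇒≤ (≤-respʳ (sym (+-identityˡ _)) (*-cancel-nonNeg 0<κβ (≤-respʳ (begin
          θ i                                  ≈⟨ off i≢β i≢j ⟨
          κ i
            ≈⟨ solve 3 (λ x a y → x := (x :+ a :* y) :+ a :* :- y) refl (κ i) (κ β) (ν i) ⟩
          (κ i + κ β * ν i) + κ β * - ν i      ≈⟨ +-congʳ (dependence-unique κ sumκ≈0 𝒜κ≋0 κ⊂ν i) ⟩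
          0# + κ β * - ν i                     ≈⟨ +-identityˡ _ ⟩
          κ β * - ν i                          ∎) (0≤θ i)))))
        (proj₁ ν*∈N i i≢β)

      ν≋ : ν ≋ (ν j ·ᵥ e j -ᵥ e β)
      ν≋ i with i Fin.≟ β | i Fin.≟ j
      ... | yes ≡.refl | _ = begin
        ν i                      ≈⟨ νβ≈-1 ⟩
        - 1#                     ≈⟨ solve 1 (λ x → :- con (+ 1) := x :* con (+ 0) :- con (+ 1)) refl (ν j) ⟩
        ν j * 0# - 1#            ≈⟨ +-cong (*-congˡ (reflexive (e-off j≢β))) (-‿cong (reflexive (e-diag i))) ⟨
        ν j * e j i - e i i      ∎
      ... | no i≢β | yes ≡.refl = begin
        ν i                      ≈⟨ solve 1 (λ x → x := x :* con (+ 1) :- con (+ 0)) refl (ν i) ⟩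
        ν i * 1# - 0#
          ≈⟨ +-cong (*-congˡ (reflexive (e-diag i))) (-‿cong (reflexive (e-off (i≢β ∘ ≡.sym)))) ⟨
        ν i * e i i - e β i      ∎
      ... | no i≢β | no i≢j = begin
        ν i                      ≈⟨ ν≈0-off i≢β i≢j ⟩
        0#                       ≈⟨ solve 1 (λ x → con (+ 0) := x :* con (+ 0) :- con (+ 0)) refl (ν j) ⟩
        ν j * 0# - 0#
          ≈⟨ +-cong (*-congˡ (reflexive (e-off (i≢j ∘ ≡.sym)))) (-‿cong (reflexive (e-off (i≢β ∘ ≡.sym)))) ⟨
        ν j * e j i - e β i      ∎

      eval-ν : ∀ x → ⟨ x , ν ⟩ ≈ ν j * x j - x β
      eval-ν x = begin
        ⟨ x , ν ⟩                                ≈⟨ ⟨⟩-congˡ x ν≋ ⟩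
        ⟨ x , ν j ·ᵥ e j -ᵥ e β ⟩                ≈⟨ ⟨⟩-+ x (ν j ·ᵥ e j) (-ᵥ e β) ⟩
        ⟨ x , ν j ·ᵥ e j ⟩ + ⟨ x , -ᵥ e β ⟩      ≈⟨ +-cong (trans (⟨⟩-· x (ν j) (e j)) (*-congˡ (⟨⟩-e x j)))
                                                      (trans (⟨⟩-neg x (e β)) (-‿cong (⟨⟩-e x β))) ⟩
        ν j * x j - x β                          ∎

      -- Only `j` and `β` are left in the support, so the zero sum balances `ν j` against `- 1#`.
      νj≈1 : ν j ≈ 1#
      νj≈1 = begin
        ν j
          ≈⟨ solve 1 (λ x → x := x :* con (+ 1) :- con (+ 1) :+ con (+ 1)) refl (ν j) ⟩
        ν j * 1# - 1# + 1#                ≈⟨ +-congʳ (eval-ν (λ _ → 1#)) ⟨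
        ⟨ (λ _ → 1#) , ν ⟩ + 1#           ≈⟨ +-congʳ (trans (sym (sum≈⟨1,⟩ ν)) (proj₂ ν*∈N)) ⟩
        0# + 1#                           ≈⟨ +-identityˡ 1# ⟩
        1#                                ∎

      -- As κ_β ≠ 0, 𝒜 ν = 0, and for ν = e_j - e_β this is the claimed equality.
      𝒜β≋𝒜j : 𝒜 β ≋ 𝒜 j
      𝒜β≋𝒜j k = begin
        𝒜 β k                             ≈⟨ +-identityʳ _ ⟨
        𝒜 β k + 0#                        ≈⟨ +-congˡ (combination≈0 κ sumκ≈0 𝒜κ≋0 κ⊂ν (<⇒≉0 0<κβ) k) ⟨
        𝒜 β k + combination 𝒜 ν k         ≈⟨ +-congˡ (eval-ν (λ i → 𝒜 i k)) ⟩
        𝒜 β k + (ν j * 𝒜 j k - 𝒜 β k)     ≈⟨ +-congˡ (+-congʳ (*-congʳ νj≈1)) ⟩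
        𝒜 β k + (1# * 𝒜 j k - 𝒜 β k)
          ≈⟨ solve 2 (λ a b → b :+ (con (+ 1) :* a :- b) := a) refl (𝒜 j k) (𝒜 β k) ⟩
        𝒜 j k                             ∎

theorem4p1 : (R : RealField) → let open Geometry R in
    (n : ℕ) (X : Pred (ℝ^ n) 0ℓ) → X Respects _≋_ → Satisfiable X → IsConvex X →
    (m : ℕ) (𝒜 : Fin m → ℝ^ n) → Injective _≡_ _≋_ 𝒜 →
    (β : Fin m) (ν : ℝ^ m) → ν ∈ Λ 𝒜 X β →
    Empty (relint (conv (supp 𝒜 ν)) ∩ (_⁺ 𝒜 ν)) ×
    (𝒜 β ∈ conv (_⁺ 𝒜 ν) → combination 𝒜 ν ≋ 0ᵥ)
theorem4p1 R n X _ nonEmpty _ m 𝒜 injective β ν (circuit , νβ≈-1) =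
  relint-disjoint nonEmpty 𝒜 circuit νβ≈-1 injective ,
  β∈conv⇒combination≈0 nonEmpty 𝒜 circuit νβ≈-1
  where open CircuitTheory R
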